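{- For any $0<\alpha,\beta<1$ and any positive integer $p$, there are positive integers $k,\ell$ such that $\mathrm{Z}_{\alpha,\beta}(G(\ell,k)-vx)-\mathrm{Z}_{\alpha,\beta}(G(\ell,k))\ge p$.
   Context: All graphs are finite and simple. $G-e$ denotes the graph obtained from $G$ by deleting the edge $e$. For positive integers $\ell,k$, $G(\ell,k)$ is the graph obtained by identifying a degree-1 vertex of the path $P_{k+1}$ on $k+1$ vertices with the central vertex of the star $K_{1,\ell}$; the identified vertex is called $v$ and its neighbor on the path is called $x$. Let $\alpha,\beta$ be the transmission proportion and the transmission threshold, let $G$ be a graph and $B\subseteq V(G)$ a set of initially filled vertices. The transmission forcing process started from $B$ is defined as follows. Put $B_0=B$, $w_0(v)=1$ for $v\in B$ and $w_0(v)=0$ for $v\in V(G)\setminus B$. For $t\ge 1$, given the set $B_{t-1}$ of vertices filled at time $t-1$ and the weights $w_{t-1}$: for each unfilled vertex $u\in V(G)\setminus B_{t-1}$ let $\mathcal V_{t,u}$ be the set of all $v\in B_{t-1}$ such that $u$ is the only neighbor of $v$ in $V(G)\setminus B_{t-1}$ and $v\notin \mathcal V_{s,u'}$ for every $s<t$ and every $u'$ (each vertex transmits weight at most once); when $v\in\mathcal V_{t,u}$ we say $v$ forces $u$, written $v\to u$. Set $w_t(u)=w_{t-1}(u)+\sum_{v\in\mathcal V_{t,u}}\alpha\, w_{t-1}(v)$ for $u\in V(G)\setminus B_{t-1}$ and $w_t(u)=w_{t-1}(u)$ for $u\in B_{t-1}$. Then $B_t=B_{t-1}\cup\{u\in V(G)\setminus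 B_{t-1} : w_t(u)\ge\beta\}$. The set $B$ is an $(\alpha,\beta)$-transmission zero forcing set of $G$ if $B_t=V(G)$ for some $t\ge 0$, and the $(\alpha,\beta)$-transmission zero forcing number $\mathrm{Z}_{\alpha,\beta}(G)$ is the minimum cardinality of such a set. -}

module Defs where

open import Axiom.ExcludedMiddle using (ExcludedMiddle)
open import Data.Empty using (⊥)
open import Data.Fin using (Fin; zero; suc; toℕ; splitAt; _↑ʳ_)
open import Data.Fin.Subset using (Subset; _∈_; ∣_∣; ⊤)
open import Data.Fin.Subset.Properties using (∈⊤)
open import Data.Nat as ℕ using (ℕ; zero; suc; s≤s; NonZero)
import Data.Nat.Properties as ℕ
open import Data.Product using (∃; _×_; _,_; proj₁)
open import Data.Rational as ℚ using (ℚ; 0ℚ; 1ℚ; ½; 1/_)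
import Data.Rational.Properties as ℚ
open import Data.Rational.Solver using (module +-*-Solver)
open import Data.Sum using (_⊎_; inj₁; inj₂; swap; [_,_]′)
import Data.Vec.Functional as Vector
open import Function using (_∘_; const)
open import Level using (0ℓ)
open import Relation.Binary using (Rel; Symmetric; Irreflexive)
open import Relation.Binary.PropositionalEquality
open import Relation.Nullary using (yes; no; does; ¬_; contradiction)
open import Data.Bool using (if_then_else_)

-- Real numbers: Cauchy sequences of rationals.  No quotient is taken;
-- x and y denote the same real iff x ≤ y and y ≤ x, and the operations
-- below respect this.

CloseWithin : ℚ → (ℕ → ℚ) → Set
CloseWithin ε f =
  ∃ λ N → ∀ m n → N ℕ.≤ m → N ℕ.≤ n → ℚ.∣ f m ℚ.- f n ∣ ℚ.< ε

IsCauchy : (ℕ → ℚ) → Set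
IsCauchy f = ∀ ε → 0ℚ ℚ.< ε → CloseWithin ε f

EventuallyBounded : (ℕ → ℚ) → Set
EventuallyBounded f = ∃ λ A → ℚ.Positive A × ∃ λ N → ∀ n → N ℕ.≤ n → ℚ.∣ f n ∣ ℚ.≤ A

private abstract

  cauchy-const : ∀ q → IsCauchy (const q)
  cauchy-const q ε 0<ε = 0 , λ _ _ _ _ →
    subst (ℚ._< ε) (sym (cong ℚ.∣_∣ (ℚ.+-inverseʳ q))) 0<ε

  cauchy-+ : ∀ {f g} → IsCauchy f → IsCauchy g → IsCauchy (λ n → f n ℚ.+ g n)
  cauchy-+ {f} {g} cf cg ε 0<ε = go (cf (½ ℚ.* ε) 0<½ε) (cg (½ ℚ.* ε) 0<½ε)
    where
    0<½ε : 0ℚ ℚ.< ½ ℚ.* ε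
    0<½ε = subst (ℚ._< ½ ℚ.* ε) (ℚ.*-zeroʳ ½) (ℚ.*-monoʳ-<-pos ½ 0<ε)
    open +-*-Solver
    regroup : ∀ a b c d → (a ℚ.+ b) ℚ.- (c ℚ.+ d) ≡ (a ℚ.- c) ℚ.+ (b ℚ.- d)
    regroup = solve 4 (λ a b c d → (a :+ b) :- (c :+ d) := (a :- c) :+ (b :- d)) refl
    halves : ½ ℚ.* ε ℚ.+ ½ ℚ.* ε ≡ ε
    halves = trans (sym (ℚ.*-distribʳ-+ ε ½ ½)) (ℚ.*-identityˡ ε)
    go : CloseWithin (½ ℚ.* ε) f → CloseWithin (½ ℚ.* ε) g →
         CloseWithin ε (λ n → f n ℚ.+ g n)
    go (N , hf) (M , hg) = N ℕ.⊔ M , λ m n p q → begin-strict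
      ℚ.∣ (f m ℚ.+ g m) ℚ.- (f n ℚ.+ g n) ∣
        ≡⟨ cong ℚ.∣_∣ (regroup (f m) (g m) (f n) (g n)) ⟩
      ℚ.∣ (f m ℚ.- f n) ℚ.+ (g m ℚ.- g n) ∣
        ≤⟨ ℚ.∣p+q∣≤∣p∣+∣q∣ (f m ℚ.- f n) (g m ℚ.- g n) ⟩
      ℚ.∣ f m ℚ.- f n ∣ ℚ.+ ℚ.∣ g m ℚ.- g n ∣
        <⟨ ℚ.+-mono-< (hf m n (ℕ.m⊔n≤o⇒m≤o N M p) (ℕ.m⊔n≤o⇒m≤o N M q))
                      (hg m n (ℕ.m⊔n≤o⇒n≤o N M p) (ℕ.m⊔n≤o⇒n≤o N M q)) ⟩
      ½ ℚ.* ε ℚ.+ ½ ℚ.* ε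
        ≡⟨ halves ⟩
      ε ∎
      where open ℚ.≤-Reasoning

  cauchy-bounded : ∀ {f} → IsCauchy f → EventuallyBounded f
  cauchy-bounded {f} cf with cf 1ℚ (ℚ.positive⁻¹ 1ℚ)
  ... | N , h = 1ℚ ℚ.+ ℚ.∣ f N ∣
              , ℚ.pos+nonNeg⇒pos 1ℚ ℚ.∣ f N ∣ {{ℚ.∣-∣-nonNeg (f N)}}
              , N , bound
    where
    open +-*-Solver
    split : ∀ a b → a ≡ (a ℚ.- b) ℚ.+ b
    split = solve 2 (λ a b → a := (a :- b) :+ b) refl
    open ℚ.≤-Reasoning
    bound : ∀ n → N ℕ.≤ n → ℚ.∣ f n ∣ ℚ.≤ 1ℚ ℚ.+ ℚ.∣ f N ∣
    bound n p = begin
      ℚ.∣ f n ∣                         ≡⟨ cong ℚ.∣_∣ (split (f n) (f N)) ⟩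
      ℚ.∣ (f n ℚ.- f N) ℚ.+ f N ∣       ≤⟨ ℚ.∣p+q∣≤∣p∣+∣q∣ (f n ℚ.- f N) (f N) ⟩
      ℚ.∣ f n ℚ.- f N ∣ ℚ.+ ℚ.∣ f N ∣   ≤⟨ ℚ.+-monoˡ-≤ ℚ.∣ f N ∣ (ℚ.<⇒≤ (h n N p ℕ.≤-refl)) ⟩
      1ℚ ℚ.+ ℚ.∣ f N ∣                  ∎

  divide : ∀ C → ℚ.Positive C → ∀ ε → 0ℚ ℚ.< ε → ∃ λ δ → 0ℚ ℚ.< δ × C ℚ.* δ ≡ ε
  divide C C>0 ε 0<ε = C⁻¹ ℚ.* ε
    , subst (ℚ._< C⁻¹ ℚ.* ε) (ℚ.*-zeroʳ C⁻¹)
        (ℚ.*-monoʳ-<-pos C⁻¹ {{ℚ.1/pos⇒pos C {{C>0}}}} 0<ε)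
    , trans (sym (ℚ.*-assoc C C⁻¹ ε))
        (trans (cong (ℚ._* ε) (ℚ.*-inverseʳ C {{C≢0}})) (ℚ.*-identityˡ ε))
    where
    C≢0 : ℚ.NonZero C
    C≢0 = ℚ.pos⇒nonZero C {{C>0}}
    C⁻¹ : ℚ
    C⁻¹ = (1/ C) {{C≢0}}

  term-bound : ∀ C → ℚ.Positive C → ∀ {δ a x} →
    ℚ.∣ a ∣ ℚ.≤ C → ℚ.∣ x ∣ ℚ.< δ → ℚ.∣ a ℚ.* x ∣ ℚ.< C ℚ.* δ
  term-bound C C>0 {δ} {a} {x} a≤C x<δ = begin-strict
    ℚ.∣ a ℚ.* x ∣        ≡⟨ ℚ.∣p*q∣≡∣p∣*∣q∣ a x ⟩
    ℚ.∣ a ∣ ℚ.* ℚ.∣ x ∣  ≤⟨ ℚ.*-monoʳ-≤-nonNeg ℚ.∣ x ∣ {{ℚ.∣-∣-nonNeg x}} a≤C ⟩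
    C ℚ.* ℚ.∣ x ∣        <⟨ ℚ.*-monoʳ-<-pos C {{C>0}} x<δ ⟩
    C ℚ.* δ              ∎
    where open ℚ.≤-Reasoning

  product-bound : ∀ A B → ℚ.Positive A → ℚ.Positive B → ∀ {δ} a b c d →
    ℚ.∣ a ∣ ℚ.≤ A → ℚ.∣ d ∣ ℚ.≤ B → ℚ.∣ a ℚ.- c ∣ ℚ.< δ → ℚ.∣ b ℚ.- d ∣ ℚ.< δ →
    ℚ.∣ a ℚ.* b ℚ.- c ℚ.* d ∣ ℚ.< (A ℚ.+ B) ℚ.* δ
  product-bound A B A>0 B>0 {δ} a b c d a≤A d≤B a-c<δ b-d<δ = begin-strict
    ℚ.∣ a ℚ.* b ℚ.- c ℚ.* d ∣
      ≡⟨ cong ℚ.∣_∣ regroup ⟩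
    ℚ.∣ a ℚ.* (b ℚ.- d) ℚ.+ d ℚ.* (a ℚ.- c) ∣
      ≤⟨ ℚ.∣p+q∣≤∣p∣+∣q∣ (a ℚ.* (b ℚ.- d)) (d ℚ.* (a ℚ.- c)) ⟩
    ℚ.∣ a ℚ.* (b ℚ.- d) ∣ ℚ.+ ℚ.∣ d ℚ.* (a ℚ.- c) ∣
      <⟨ ℚ.+-mono-< (term-bound A A>0 {δ} {a} {b ℚ.- d} a≤A b-d<δ)
                    (term-bound B B>0 {δ} {d} {a ℚ.- c} d≤B a-c<δ) ⟩
    A ℚ.* δ ℚ.+ B ℚ.* δ
      ≡⟨ sym (ℚ.*-distribʳ-+ δ A B) ⟩
    (A ℚ.+ B) ℚ.* δ ∎
    where
    open ℚ.≤-Reasoning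
    open +-*-Solver
    regroup : a ℚ.* b ℚ.- c ℚ.* d ≡ a ℚ.* (b ℚ.- d) ℚ.+ d ℚ.* (a ℚ.- c)
    regroup = solve 4 (λ a b c d → a :* b :- c :* d := a :* (b :- d) :+ d :* (a :- c))
                refl a b c d

  cauchy-* : ∀ {f g} → IsCauchy f → IsCauchy g → IsCauchy (λ n → f n ℚ.* g n)
  cauchy-* {f} {g} cf cg ε 0<ε = bounded (cauchy-bounded {f} cf) (cauchy-bounded {g} cg)
    where
    close : ∀ A B → ℚ.Positive A → ℚ.Positive B → ∀ {δ} → (A ℚ.+ B) ℚ.* δ ≡ ε → ∀ K L →
            (∀ n → K ℕ.≤ n → ℚ.∣ f n ∣ ℚ.≤ A) → (∀ n → L ℕ.≤ n → ℚ.∣ g n ∣ ℚ.≤ B) →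
            CloseWithin δ f → CloseWithin δ g → CloseWithin ε (λ n → f n ℚ.* g n)
    close A B A>0 B>0 {δ} [A+B]δ≡ε K L f≤A g≤B (N , hf) (M , hg) =
      (K ℕ.⊔ L) ℕ.⊔ (N ℕ.⊔ M) , bound
      where
      bound : ∀ m n → (K ℕ.⊔ L) ℕ.⊔ (N ℕ.⊔ M) ℕ.≤ m → (K ℕ.⊔ L) ℕ.⊔ (N ℕ.⊔ M) ℕ.≤ n →
              ℚ.∣ f m ℚ.* g m ℚ.- f n ℚ.* g n ∣ ℚ.< ε
      bound m n p q = subst (ℚ.∣ f m ℚ.* g m ℚ.- f n ℚ.* g n ∣ ℚ.<_) [A+B]δ≡ε
        (product-bound A B A>0 B>0 {δ} (f m) (g m) (f n) (g n)
          (f≤A m (ℕ.m⊔n≤o⇒m≤o K L KLm)) (g≤B n (ℕ.m⊔n≤o⇒n≤o K L KLn))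
          (hf m n (ℕ.m⊔n≤o⇒m≤o N M NMm) (ℕ.m⊔n≤o⇒m≤o N M NMn))
          (hg m n (ℕ.m⊔n≤o⇒n≤o N M NMm) (ℕ.m⊔n≤o⇒n≤o N M NMn)))
        where
        KLm : K ℕ.⊔ L ℕ.≤ m
        KLm = ℕ.m⊔n≤o⇒m≤o (K ℕ.⊔ L) (N ℕ.⊔ M) p
        KLn : K ℕ.⊔ L ℕ.≤ n
        KLn = ℕ.m⊔n≤o⇒m≤o (K ℕ.⊔ L) (N ℕ.⊔ M) q
        NMm : N ℕ.⊔ M ℕ.≤ m
        NMm = ℕ.m⊔n≤o⇒n≤o (K ℕ.⊔ L) (N ℕ.⊔ M) p
        NMn : N ℕ.⊔ M ℕ.≤ n
        NMn = ℕ.m⊔n≤o⇒n≤o (K ℕ.⊔ L) (N ℕ.⊔ M) q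
    bounded : EventuallyBounded f → EventuallyBounded g → CloseWithin ε (λ n → f n ℚ.* g n)
    bounded (A , A>0 , K , f≤A) (B , B>0 , L , g≤B) =
      divided (divide (A ℚ.+ B) (ℚ.pos+pos⇒pos A {{A>0}} B {{B>0}}) ε 0<ε)
      where
      divided : (∃ λ δ → 0ℚ ℚ.< δ × (A ℚ.+ B) ℚ.* δ ≡ ε) → CloseWithin ε (λ n → f n ℚ.* g n)
      divided (δ , 0<δ , eq) = close A B A>0 B>0 {δ} eq K L f≤A g≤B (cf δ 0<δ) (cg δ 0<δ)

record ℝ : Set where
  constructor _by_
  field
    seq    : ℕ → ℚ
    cauchy : IsCauchy seq

open ℝ public

infix  4 _<_ _≤_
infixl 6 _+_
infixl 7 _*_

0ℝ 1ℝ : ℝ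
0ℝ = const 0ℚ by cauchy-const 0ℚ
1ℝ = const 1ℚ by cauchy-const 1ℚ

_+_ _*_ : ℝ → ℝ → ℝ
x + y = (λ n → seq x n ℚ.+ seq y n) by cauchy-+ {seq x} {seq y} (cauchy x) (cauchy y)
x * y = (λ n → seq x n ℚ.* seq y n) by cauchy-* {seq x} {seq y} (cauchy x) (cauchy y)

_<_ _≤_ : Rel ℝ 0ℓ
x < y = ∃ λ ε → 0ℚ ℚ.< ε × ∃ λ N → ∀ n → N ℕ.≤ n → seq x n ℚ.+ ε ℚ.≤ seq y n
x ≤ y = ¬ (y < x)

sum : ∀ {n} → (Fin n → ℝ) → ℝ
sum = Vector.foldr _+_ 0ℝ

record Graph : Set₁ where
  field
    order    : ℕ
    _~_      : Rel (Fin order) 0ℓ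
    ~-sym    : Symmetric _~_
    ~-irrefl : Irreflexive _≡_ _~_

  Vertex : Set
  Vertex = Fin order

open Graph using (Vertex)

deleteEdge : (G : Graph) → Vertex G → Vertex G → Graph
deleteEdge G u v = record
  { order    = Graph.order G
  ; _~_      = λ a b → a ~ b × ¬ ((a ≡ u × b ≡ v) ⊎ (a ≡ v × b ≡ u))
  ; ~-sym    = λ (ab , ne) → ~-sym ab , λ where
      (inj₁ (b≡u , a≡v)) → ne (inj₂ (a≡v , b≡u))
      (inj₂ (b≡v , a≡u)) → ne (inj₁ (a≡u , b≡v))
  ; ~-irrefl = λ a≡b (ab , _) → ~-irrefl a≡b ab
  }
  where open Graph G

-- G(ℓ,k).  A vertex is either one of the ℓ leaves of the star K_{1,ℓ}
-- or one of the k+1 vertices 0, …, k of the path P_{k+1}; the star's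
-- centre has been identified with the path vertex 0.  That vertex is v
-- (`centre`), and x (`pathNeighbour`) is the path vertex 1.

module _ {ℓ k : ℕ} where

  StarPathAdj : Rel (Fin ℓ ⊎ Fin (suc k)) 0ℓ
  StarPathAdj (inj₁ _) (inj₁ _) = ⊥
  StarPathAdj (inj₁ _) (inj₂ j) = j ≡ zero
  StarPathAdj (inj₂ i) (inj₁ _) = i ≡ zero
  StarPathAdj (inj₂ i) (inj₂ j) = toℕ j ≡ suc (toℕ i) ⊎ toℕ i ≡ suc (toℕ j)

  private

    adj-sym : Symmetric StarPathAdj
    adj-sym {inj₁ _} {inj₂ _} e = e
    adj-sym {inj₂ _} {inj₁ _} e = e
    adj-sym {inj₂ _} {inj₂ _} e = swap e

    adj-irrefl : ∀ a → ¬ StarPathAdj a a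
    adj-irrefl (inj₂ i) = [ ℕ.1+n≢n ∘ sym , ℕ.1+n≢n ∘ sym ]′

  starPath-sym : Symmetric {A = Fin (ℓ ℕ.+ suc k)}
                   (λ a b → StarPathAdj (splitAt ℓ a) (splitAt ℓ b))
  starPath-sym {a} {b} = adj-sym {splitAt ℓ a} {splitAt ℓ b}

  starPath-irrefl : Irreflexive {A = Fin (ℓ ℕ.+ suc k)} _≡_
                      (λ a b → StarPathAdj (splitAt ℓ a) (splitAt ℓ b))
  starPath-irrefl {a} refl = adj-irrefl (splitAt ℓ a)

StarPath : (ℓ k : ℕ) → Graph
StarPath ℓ k = record
  { order    = ℓ ℕ.+ suc k
  ; _~_      = λ a b → StarPathAdj (splitAt ℓ a) (splitAt ℓ b)
  ; ~-sym    = λ {a} {b} → starPath-sym {ℓ} {k} {a} {b}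
  ; ~-irrefl = λ {a} {b} → starPath-irrefl {ℓ} {k} {a} {b}
  }

centre : ∀ ℓ k → Vertex (StarPath ℓ k)
centre ℓ k = ℓ ↑ʳ zero

pathNeighbour : ∀ ℓ k → .{{NonZero k}} → Vertex (StarPath ℓ k)
pathNeighbour ℓ (suc k) = ℓ ↑ʳ suc zero

IsLeast : (ℕ → Set) → ℕ → Set
IsLeast P m = P m × (∀ n → P n → m ℕ.≤ n)

least : ExcludedMiddle 0ℓ → (P : ℕ → Set) → ∀ n → P n → ∃ (IsLeast P)
least em P n pn with em {P 0}
least em P n       pn | yes p0 = 0 , p0 , λ _ _ → ℕ.z≤n
least em P zero    pn | no ¬p0 = contradiction pn ¬p0
least em P (suc n) pn | no ¬p0 with least em (P ∘ suc) n pn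
... | m , pm , m≤ = suc m , pm , λ where
  zero    p0 → contradiction p0 ¬p0
  (suc i) pi → s≤s (m≤ i pi)

-- Comparison of reals is not decidable constructively, so excluded
-- middle is taken as a parameter.

module Process (em : ExcludedMiddle 0ℓ) (α β : ℝ) (G : Graph) where

  open Graph G using (_~_)

  _when_ : ℝ → Set → ℝ
  r when P = if does (em {P}) then r else 0ℝ

  module _ (B : Subset (Graph.order G)) where

    -- Filled t u        : u ∈ B_t
    -- Forces t v u      : v ∈ 𝒱_{t+1,u}
    -- Transmitted t v   : v ∈ 𝒱_{s,u} for some u and some 1 ≤ s ≤ t
    -- weight t u        : w_t(u)
    mutual

      Filled : ℕ → Vertex G → Set
      Filled zero    u = u ∈ B
      Filled (suc t) u = Filled t u ⊎ (¬ Filled t u × β ≤ weight (suc t) u)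

      Forces : ℕ → Vertex G → Vertex G → Set
      Forces t v u = Filled t v
                   × (v ~ u × ¬ Filled t u × (∀ y → v ~ y → ¬ Filled t y → y ≡ u))
                   × ¬ Transmitted t v

      Transmitted : ℕ → Vertex G → Set
      Transmitted zero    v = ⊥
      Transmitted (suc t) v = Transmitted t v ⊎ ∃ λ u → Forces t v u

      weight : ℕ → Vertex G → ℝ
      weight zero    u = 1ℝ when (u ∈ B)
      weight (suc t) u =
        if does (em {Filled t u})
        then weight t u
        else weight t u + sum (λ v → (α * weight t v) when Forces t v u)

    IsForcingSet : Set
    IsForcingSet = ∃ λ t → ∀ u → Filled t u

  ForcingSetOfSize : ℕ → Set
  ForcingSetOfSize z = ∃ λ (B : Subset (Graph.order G)) → ∣ B ∣ ≡ z × IsForcingSet B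

  forcingNumber : ∃ (IsLeast ForcingSetOfSize)
  forcingNumber = least em ForcingSetOfSize ∣ ⊤ {Graph.order G} ∣ (⊤ , refl , 0 , λ _ → ∈⊤)

Z : ExcludedMiddle 0ℓ → ℝ → ℝ → Graph → ℕ
Z em α β G = proj₁ (Process.forcingNumber em α β G)

{-# OPTIONS --safe #-}

-- In G(ℓ,k) the ℓ leaves force everything once ℓ is huge: v receives weight
-- ℓα, and this survives the k further multiplications by α along the path.
-- In G(ℓ,k) − vx two missed leaves are never filled, since v never has
-- exactly one unfilled neighbour; so ℓ − 1 leaves are needed.  On the
-- detached path a vertex that still has a neighbour to force has received
-- weight from one side only, so weights decay like α^d with the distance d
-- to the initial set, and every block of 2D + 1 consecutive vertices must
-- contain an initial vertex once 2α^D < β.  With p + 1 blocks the total is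
-- at least (ℓ − 1) + (p + 1).
--
-- All estimates are made on one rational approximation α_n, β_n at a time,
-- for n beyond a point N from which on ε ≤ α_n ≤ 1 − ε and ε ≤ β_n ≤ 1.

module Submission where

open import Defs
open import Axiom.ExcludedMiddle using (ExcludedMiddle)
open import Data.Integer using (+_; _⊖_; _≥_)
open import Data.Nat using (ℕ; NonZero)
open import Data.Product using (Σ; ∃₂; _×_)
open import Level using (0ℓ)

open import Algebra.Bundles using (CommutativeRing)
import Algebra.Properties.CommutativeMonoid.Sum as CommutativeMonoidSum
import Algebra.Properties.Semiring.Exp as SemiringExp
import Algebra.Properties.Semiring.Mult as SemiringMult
open import Data.Bool using (if_then_else_)
open import Data.Fin as Fin using (Fin; zero; suc; toℕ; fromℕ; inject₁; splitAt; combine; _↑ˡ_; _↑ʳ_)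
import Data.Fin.Properties as Fin
open import Data.Fin.Subset using (Subset; _∈_; _∉_; ∣_∣; ⊤; ⊥; inside; outside)
open import Data.Fin.Subset.Properties
  using (_∈?_; ∈⊤; ∉⊥; drop-there; ∣⊤∣≡n; ∣⊥∣≡0; p⊆q⇒∣p∣≤∣q∣; ∣p∣≤∣x∷p∣; x∈p⇒∣p-x∣<∣p∣)
import Data.Integer as ℤ
import Data.Integer.Properties as ℤ
open import Data.Nat as ℕ using (zero; suc; z≤n; s≤s)
import Data.Nat.Properties as ℕ
open import Data.Product using (∃; _,_; proj₁; proj₂)
open import Data.Rational as ℚ using (ℚ; 0ℚ; 1ℚ)
import Data.Rational.Properties as ℚ
open import Data.Rational.Solver using (module +-*-Solver)
import Data.Rational.Unnormalised as ℚᵘ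
import Data.Rational.Unnormalised.Properties as ℚᵘ
open import Data.Sum using (_⊎_; inj₁; inj₂; [_,_]′; map)
open import Data.Vec as Vec using ([]; _∷_; _++_)
import Data.Vec.Properties as Vec
open import Function using (_∘_; const; case_of_)
open import Relation.Binary.PropositionalEquality
open import Relation.Nullary using (yes; no; does; ¬_; contradiction)
open import Relation.Nullary.Decidable using (decidable-stable)

open CommutativeMonoidSum ℚ.+-0-commutativeMonoid
  using (∑-distrib-+) renaming (sum to ∑)
open CommutativeRing ℚ.+-*-commutativeRing using (semiring)
open SemiringExp semiring using (_^_)
open SemiringMult semiring
  using (×-assocˡ; ×-assoc-*; ×-comm-*) renaming (_×_ to infixr 8 _·_)

-- Rational arithmetic

*-mono-≤ : ∀ {p q r s} → 0ℚ ℚ.≤ p → 0ℚ ℚ.≤ s → p ℚ.≤ q → r ℚ.≤ s → p ℚ.* r ℚ.≤ q ℚ.* s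
*-mono-≤ {p} {q} {r} {s} 0≤p 0≤s p≤q r≤s = ℚ.≤-trans
  (ℚ.*-monoˡ-≤-nonNeg p {{ℚ.nonNegative 0≤p}} r≤s)
  (ℚ.*-monoʳ-≤-nonNeg s {{ℚ.nonNegative 0≤s}} p≤q)

*-nonNeg : ∀ {p q} → 0ℚ ℚ.≤ p → 0ℚ ℚ.≤ q → 0ℚ ℚ.≤ p ℚ.* q
*-nonNeg {p} {q} 0≤p 0≤q =
  subst (ℚ._≤ p ℚ.* q) (ℚ.*-zeroʳ p) (ℚ.*-monoˡ-≤-nonNeg p {{ℚ.nonNegative 0≤p}} 0≤q)

0≤1 : 0ℚ ℚ.≤ 1ℚ
0≤1 = ℚ.nonNegative⁻¹ 1ℚ

·-nonNeg : ∀ n {q} → 0ℚ ℚ.≤ q → 0ℚ ℚ.≤ n · q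
·-nonNeg zero    0≤q = ℚ.≤-refl
·-nonNeg (suc n) 0≤q = ℚ.+-mono-≤ 0≤q (·-nonNeg n 0≤q)

·-monoʳ-≤ : ∀ n {p q} → p ℚ.≤ q → n · p ℚ.≤ n · q
·-monoʳ-≤ zero    p≤q = ℚ.≤-refl
·-monoʳ-≤ (suc n) p≤q = ℚ.+-mono-≤ p≤q (·-monoʳ-≤ n p≤q)

^-nonNeg : ∀ {a} n → 0ℚ ℚ.≤ a → 0ℚ ℚ.≤ a ^ n
^-nonNeg zero    0≤a = 0≤1
^-nonNeg (suc n) 0≤a = *-nonNeg 0≤a (^-nonNeg n 0≤a)

^-antimono-≤ : ∀ {a} → 0ℚ ℚ.≤ a → a ℚ.≤ 1ℚ → ∀ {m n} → m ℕ.≤ n → a ^ n ℚ.≤ a ^ m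
^-antimono-≤ {a} 0≤a a≤1 {zero} {zero} z≤n = ℚ.≤-refl
^-antimono-≤ {a} 0≤a a≤1 {zero} {suc n} z≤n = subst (a ^ suc n ℚ.≤_) (ℚ.*-identityˡ 1ℚ)
  (*-mono-≤ 0≤a 0≤1 a≤1 (^-antimono-≤ 0≤a a≤1 {zero} {n} z≤n))
^-antimono-≤ {a} 0≤a a≤1 (s≤s m≤n) =
  ℚ.*-monoˡ-≤-nonNeg a {{ℚ.nonNegative 0≤a}} (^-antimono-≤ 0≤a a≤1 m≤n)

-- Unnormalised rationals are compared by cross-multiplying integers, so passing to them keeps gcds
-- out of the bound in `archimedean`.
toℚᵘ-· : ∀ n → ℚ.toℚᵘ (n · 1ℚ) ℚᵘ.≃ ℚᵘ.mkℚᵘ (+ n) 0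
toℚᵘ-· zero    = ℚᵘ.≃-refl
toℚᵘ-· (suc n) = ℚᵘ.≃-trans (ℚ.toℚᵘ-homo-+ 1ℚ (n · 1ℚ))
  (ℚᵘ.≃-trans (ℚᵘ.+-cong (ℚᵘ.≃-refl {ℚ.toℚᵘ 1ℚ}) (toℚᵘ-· n)) (ℚᵘ.*≡* (cong (ℤ._* ℤ.1ℤ) 1+n)))
  where
  1+n : ℤ.1ℤ ℤ.+ (+ n) ℤ.* ℤ.1ℤ ≡ + suc n
  1+n = cong ℤ.suc (ℤ.*-identityʳ (+ n))

-- The absolute value of the numerator suffices, because the denominator is at least 1.
archimedean : ∀ q → ∃ λ n → q ℚ.≤ n · 1ℚ
archimedean q@(ℚ.mkℚ m d _) = ℤ.∣ m ∣ , ℚ.toℚᵘ-cancel-≤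
  (ℚᵘ.≤-respʳ-≃ (ℚᵘ.≃-sym (toℚᵘ-· ℤ.∣ m ∣)) (ℚᵘ.*≤* (le m)))
  where
  le : ∀ m → m ℤ.* ℤ.1ℤ ℤ.≤ (+ ℤ.∣ m ∣) ℤ.* (+ suc d)
  le (+ n) = subst₂ ℤ._≤_ (sym (ℤ.*-identityʳ (+ n))) (ℤ.pos-* n (suc d)) (ℤ.+≤+ (ℕ.m≤m*n n (suc d)))
  le ℤ.-[1+ n ] = ℤ.-≤+

archimedean-· : ∀ {ε} → 0ℚ ℚ.< ε → ∀ q → ∃ λ n → q ℚ.≤ n · ε
archimedean-· {ε} 0<ε q = proj₁ bound , (begin
  q                            ≡⟨ ℚ.*-identityʳ q ⟨
  q ℚ.* 1ℚ                     ≡⟨ cong (q ℚ.*_) (ℚ.*-inverseˡ ε) ⟨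
  q ℚ.* (ℚ.1/ ε ℚ.* ε)         ≡⟨ ℚ.*-assoc q (ℚ.1/ ε) ε ⟨
  q ℚ.* ℚ.1/ ε ℚ.* ε           ≤⟨ ℚ.*-monoʳ-≤-nonNeg ε (proj₂ bound) ⟩
  (proj₁ bound · 1ℚ) ℚ.* ε     ≡⟨ ×-assoc-* (proj₁ bound) 1ℚ ε ⟩
  proj₁ bound · (1ℚ ℚ.* ε)     ≡⟨ cong (proj₁ bound ·_) (ℚ.*-identityˡ ε) ⟩
  proj₁ bound · ε              ∎)
  where
  open ℚ.≤-Reasoning
  instance
    ε>0 : ℚ.Positive ε
    ε>0 = ℚ.positive 0<ε
    ε≢0 : ℚ.NonZero ε
    ε≢0 = ℚ.pos⇒nonZero ε
    ε≥0 : ℚ.NonNegative ε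
    ε≥0 = ℚ.pos⇒nonNeg ε
  bound = archimedean (q ℚ.* ℚ.1/ ε)

-- The induction step is a (1 + (n+1)ε) ≤ 1 + nε, which needs only a ≤ 1 and a ≤ 1 − ε.
geometric-decay : ∀ {a ε} → 0ℚ ℚ.≤ a → 0ℚ ℚ.≤ ε → a ℚ.+ ε ℚ.≤ 1ℚ →
                  ∀ n → a ^ n ℚ.* (1ℚ ℚ.+ n · ε) ℚ.≤ 1ℚ
geometric-decay 0≤a 0≤ε a+ε≤1 zero = ℚ.≤-refl
geometric-decay {a} {ε} 0≤a 0≤ε a+ε≤1 (suc n) = begin
  a ℚ.* a ^ n ℚ.* (1ℚ ℚ.+ (ε ℚ.+ n · ε))
    ≡⟨ solve 4 (λ a x e y → a :* x :* (con 1ℚ :+ (e :+ y)) :=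
                            x :* (a :+ (a :* (e :+ y)))) refl a (a ^ n) ε (n · ε) ⟩
  a ^ n ℚ.* (a ℚ.+ (a ℚ.* (ε ℚ.+ n · ε)))
    ≤⟨ ℚ.*-monoˡ-≤-nonNeg (a ^ n) {{ℚ.nonNegative (^-nonNeg n 0≤a)}} (ℚ.+-monoʳ-≤ a
         (ℚ.*-monoʳ-≤-nonNeg (ε ℚ.+ n · ε) {{ℚ.nonNegative (·-nonNeg (suc n) 0≤ε)}} a≤1)) ⟩
  a ^ n ℚ.* (a ℚ.+ 1ℚ ℚ.* (ε ℚ.+ n · ε))
    ≡⟨ solve 4 (λ a x e y → x :* (a :+ con 1ℚ :* (e :+ y)) := x :* (a :+ e :+ y))
         refl a (a ^ n) ε (n · ε) ⟩
  a ^ n ℚ.* (a ℚ.+ ε ℚ.+ n · ε)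
    ≤⟨ ℚ.*-monoˡ-≤-nonNeg (a ^ n) {{ℚ.nonNegative (^-nonNeg n 0≤a)}} (ℚ.+-monoˡ-≤ (n · ε) a+ε≤1) ⟩
  a ^ n ℚ.* (1ℚ ℚ.+ n · ε)
    ≤⟨ geometric-decay 0≤a 0≤ε a+ε≤1 n ⟩
  1ℚ ∎
  where
  open ℚ.≤-Reasoning
  open +-*-Solver
  a≤1 : a ℚ.≤ 1ℚ
  a≤1 = ℚ.≤-trans (subst (ℚ._≤ a ℚ.+ ε) (ℚ.+-identityʳ a) (ℚ.+-monoʳ-≤ a 0≤ε)) a+ε≤1

-- Finite sums

∑-mono-≤ : ∀ {n} {f g : Fin n → ℚ} → (∀ i → f i ℚ.≤ g i) → ∑ f ℚ.≤ ∑ g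
∑-mono-≤ {zero}  f≤g = ℚ.≤-refl
∑-mono-≤ {suc n} f≤g = ℚ.+-mono-≤ (f≤g zero) (∑-mono-≤ (f≤g ∘ suc))

∑-zero : ∀ {n} {f : Fin n → ℚ} → (∀ i → f i ≡ 0ℚ) → ∑ f ≡ 0ℚ
∑-zero {zero}  f≡0 = refl
∑-zero {suc n} f≡0 = cong₂ ℚ._+_ (f≡0 zero) (∑-zero (f≡0 ∘ suc))

∑-nonNeg : ∀ {n} {f : Fin n → ℚ} → (∀ i → 0ℚ ℚ.≤ f i) → 0ℚ ℚ.≤ ∑ f
∑-nonNeg {zero}  0≤f = ℚ.≤-refl
∑-nonNeg {suc n} 0≤f = ℚ.+-mono-≤ (0≤f zero) (∑-nonNeg (0≤f ∘ suc))

term≤∑ : ∀ {n} {f : Fin n → ℚ} → (∀ i → 0ℚ ℚ.≤ f i) → ∀ i → f i ℚ.≤ ∑ f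
term≤∑ {f = f} 0≤f zero    = subst (ℚ._≤ ∑ f) (ℚ.+-identityʳ (f zero))
  (ℚ.+-monoʳ-≤ (f zero) (∑-nonNeg (0≤f ∘ suc)))
term≤∑ {f = f} 0≤f (suc i) = subst (ℚ._≤ ∑ f) (ℚ.+-identityˡ (f (suc i)))
  (ℚ.+-mono-≤ (0≤f zero) (term≤∑ (0≤f ∘ suc) i))

-- Only the first `m` indices are counted. In G(ℓ,k) these are the leaves, which all transmit to the
-- centre in the same round.
·≤∑ : ∀ m {n x} {f : Fin (m ℕ.+ n) → ℚ} → (∀ i → 0ℚ ℚ.≤ f i) →
      (∀ i → x ℚ.≤ f (i ↑ˡ n)) → m · x ℚ.≤ ∑ f
·≤∑ zero    0≤f x≤f = ∑-nonNeg 0≤f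
·≤∑ (suc m) 0≤f x≤f = ℚ.+-mono-≤ (x≤f zero) (·≤∑ m (0≤f ∘ suc) (x≤f ∘ suc))

seq-sum : ∀ {m} (f : Fin m → ℝ) n → seq (sum f) n ≡ ∑ (λ i → seq (f i) n)
seq-sum {zero}  f n = refl
seq-sum {suc m} f n = cong (seq (f zero) n ℚ.+_) (seq-sum (f ∘ suc) n)

module Indicator (em : ExcludedMiddle 0ℓ) where

  -- The rational counterpart of `_when_`: evaluating a real guarded by `_when_` at an index gives a
  -- rational guarded by the same decision.
  _onlyIf_ : ℚ → Set → ℚ
  x onlyIf P = if does (em {P}) then x else 0ℚ

  module _ {x : ℚ} {P : Set} where

    onlyIf-true : P → x onlyIf P ≡ x
    onlyIf-true p with em {P}
    ... | yes _ = refl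
    ... | no ¬p = contradiction p ¬p

    onlyIf-false : ¬ P → x onlyIf P ≡ 0ℚ
    onlyIf-false ¬p with em {P}
    ... | yes p = contradiction p ¬p
    ... | no _  = refl

    onlyIf-nonNeg : 0ℚ ℚ.≤ x → 0ℚ ℚ.≤ x onlyIf P
    onlyIf-nonNeg 0≤x with em {P}
    ... | yes _ = 0≤x
    ... | no _  = ℚ.≤-refl

    onlyIf-mono-≤ : ∀ {Q : Set} → 0ℚ ℚ.≤ x → (P → Q) → x onlyIf P ℚ.≤ x onlyIf Q
    onlyIf-mono-≤ {Q} 0≤x P⇒Q with em {P} | em {Q}
    ... | yes p | no ¬q = contradiction (P⇒Q p) ¬q
    ... | yes _ | yes _ = ℚ.≤-refl
    ... | no _  | yes _ = 0≤x
    ... | no _  | no _  = ℚ.≤-refl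

  module _ {x : ℚ} (0≤x : 0ℚ ℚ.≤ x) where

    ∑-onlyIf-unique : ∀ {n} (P : Fin n → Set) → (∀ i j → P i → P j → i ≡ j) →
                      ∑ (λ i → x onlyIf P i) ℚ.≤ x
    ∑-onlyIf-unique {zero}  P unique = 0≤x
    ∑-onlyIf-unique {suc n} P unique with em {P zero}
    ... | yes p = ℚ.≤-reflexive (trans (cong (x ℚ.+_) (∑-zero λ i →
                    onlyIf-false λ q → case unique zero (suc i) p q of λ ())) (ℚ.+-identityʳ x))
    ... | no _  = subst (ℚ._≤ x) (sym (ℚ.+-identityˡ _))
                    (∑-onlyIf-unique (P ∘ suc) λ i j p q → Fin.suc-injective (unique (suc i) (suc j) p q))

    -- Once the first index satisfying `P` is split off, any two later ones coincide, so
    -- `∑-onlyIf-unique` bounds the rest.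
    ∑-onlyIf-pair : ∀ {n} (P : Fin n → Set) →
                    (∀ i j k → P i → P j → P k → i ≡ j ⊎ i ≡ k ⊎ j ≡ k) →
                    ∑ (λ i → x onlyIf P i) ℚ.≤ x ℚ.+ x
    ∑-onlyIf-pair {zero}  P pair = ℚ.+-mono-≤ 0≤x 0≤x
    ∑-onlyIf-pair {suc n} P pair with em {P zero}
    ... | yes p = ℚ.+-monoʳ-≤ x (∑-onlyIf-unique (P ∘ suc) λ i j q r →
                    case pair zero (suc i) (suc j) p q r of λ where
                      (inj₂ (inj₂ eq)) → Fin.suc-injective eq)
    ... | no _  = subst (ℚ._≤ x ℚ.+ x) (sym (ℚ.+-identityˡ _))
                    (∑-onlyIf-pair (P ∘ suc) λ i j k p q r →
                      case pair (suc i) (suc j) (suc k) p q r of λ where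
                        (inj₁ eq)        → inj₁ (Fin.suc-injective eq)
                        (inj₂ (inj₁ eq)) → inj₂ (inj₁ (Fin.suc-injective eq))
                        (inj₂ (inj₂ eq)) → inj₂ (inj₂ (Fin.suc-injective eq)))

-- The transmission process

record Separated (α β : ℝ) (ε : ℚ) (N : ℕ) : Set where
  field
    0<ε   : 0ℚ ℚ.< ε
    ε≤α   : ∀ n → N ℕ.≤ n → ε ℚ.≤ seq α n
    α+ε≤1 : ∀ n → N ℕ.≤ n → seq α n ℚ.+ ε ℚ.≤ 1ℚ
    ε≤β   : ∀ n → N ℕ.≤ n → ε ℚ.≤ seq β n
    β≤1   : ∀ n → N ℕ.≤ n → seq β n ℚ.≤ 1ℚ

  0≤ε : 0ℚ ℚ.≤ ε
  0≤ε = ℚ.<⇒≤ 0<ε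

  0≤α : ∀ n → N ℕ.≤ n → 0ℚ ℚ.≤ seq α n
  0≤α n N≤n = ℚ.≤-trans 0≤ε (ε≤α n N≤n)

  α≤1 : ∀ n → N ℕ.≤ n → seq α n ℚ.≤ 1ℚ
  α≤1 n N≤n = ℚ.≤-trans
    (subst (ℚ._≤ seq α n ℚ.+ ε) (ℚ.+-identityʳ (seq α n)) (ℚ.+-monoʳ-≤ (seq α n) 0≤ε))
    (α+ε≤1 n N≤n)

0<⊓ : ∀ {p q} → 0ℚ ℚ.< p → 0ℚ ℚ.< q → 0ℚ ℚ.< p ℚ.⊓ q
0<⊓ {p} {q} 0<p 0<q with ℚ.⊓-sel p q
... | inj₁ eq = subst (0ℚ ℚ.<_) (sym eq) 0<p
... | inj₂ eq = subst (0ℚ ℚ.<_) (sym eq) 0<q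

-- Each strict inequality of reals unfolds to a rational gap and an index from which it holds. A
-- minimum of gaps and a maximum of indices serve all bounds at once.
separate : ∀ {α β} → 0ℝ < α → α < 1ℝ → 0ℝ < β → β < 1ℝ → ∃₂ λ ε N → Separated α β ε N
separate {α} {β} (a , 0<a , A , 0<α) (b , 0<b , B , α<1) (c , 0<c , C , 0<β) (d , 0<d , D , β<1) =
  a ℚ.⊓ b ℚ.⊓ c , (A ℕ.⊔ B) ℕ.⊔ (C ℕ.⊔ D) , record
  { 0<ε   = 0<⊓ (0<⊓ 0<a 0<b) 0<c
  ; ε≤α   = λ n p → ℚ.≤-trans (ℚ.≤-trans (ℚ.p⊓q≤p (a ℚ.⊓ b) c) (ℚ.p⊓q≤p a b))
              (subst (ℚ._≤ seq α n) (ℚ.+-identityˡ a)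
                (0<α n (ℕ.m⊔n≤o⇒m≤o A B (ℕ.m⊔n≤o⇒m≤o (A ℕ.⊔ B) (C ℕ.⊔ D) p))))
  ; α+ε≤1 = λ n p → ℚ.≤-trans
              (ℚ.+-monoʳ-≤ (seq α n) (ℚ.≤-trans (ℚ.p⊓q≤p (a ℚ.⊓ b) c) (ℚ.p⊓q≤q a b)))
              (α<1 n (ℕ.m⊔n≤o⇒n≤o A B (ℕ.m⊔n≤o⇒m≤o (A ℕ.⊔ B) (C ℕ.⊔ D) p)))
  ; ε≤β   = λ n p → ℚ.≤-trans (ℚ.p⊓q≤q (a ℚ.⊓ b) c)
              (subst (ℚ._≤ seq β n) (ℚ.+-identityˡ c)
                (0<β n (ℕ.m⊔n≤o⇒m≤o C D (ℕ.m⊔n≤o⇒n≤o (A ℕ.⊔ B) (C ℕ.⊔ D) p))))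
  ; β≤1   = λ n p → ℚ.≤-trans
              (subst (ℚ._≤ seq β n ℚ.+ d) (ℚ.+-identityʳ (seq β n)) (ℚ.+-monoʳ-≤ (seq β n) (ℚ.<⇒≤ 0<d)))
              (β<1 n (ℕ.m⊔n≤o⇒n≤o C D (ℕ.m⊔n≤o⇒n≤o (A ℕ.⊔ B) (C ℕ.⊔ D) p)))
  }

module Dynamics (em : ExcludedMiddle 0ℓ) {α β : ℝ} {ε : ℚ} {N : ℕ} (sep : Separated α β ε N)
                (G : Graph) (B : Subset (Graph.order G)) where

  open Graph G using (_~_; Vertex)
  open Separated sep
  open Indicator em
  open Process em α β G using (_when_)

  Filled : ℕ → Vertex → Set
  Filled = Process.Filled em α β G B

  Forces : ℕ → Vertex → Vertex → Set
  Forces = Process.Forces em α β G B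

  Transmitted : ℕ → Vertex → Set
  Transmitted = Process.Transmitted em α β G B

  weight : ℕ → Vertex → ℝ
  weight = Process.weight em α β G B

  transmission : ℕ → ℕ → Vertex → Vertex → ℚ
  transmission n t u y = seq ((α * weight t y) when Forces t y u) n

  transmission-onlyIf : ∀ n t u y →
    transmission n t u y ≡ (seq α n ℚ.* seq (weight t y) n) onlyIf Forces t y u
  transmission-onlyIf n t u y with em {Forces t y u}
  ... | yes _ = refl
  ... | no _  = refl

  weight-filled : ∀ {t u} → Filled t u → weight (suc t) u ≡ weight t u
  weight-filled {t} {u} f with em {Filled t u}
  ... | yes _ = refl
  ... | no ¬f = contradiction f ¬f

  weight-unfilled : ∀ {t u} n → ¬ Filled t u →
    seq (weight (suc t) u) n ≡ seq (weight t u) n ℚ.+ ∑ (transmission n t u)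
  weight-unfilled {t} {u} n ¬f with em {Filled t u}
  ... | yes f = contradiction f ¬f
  ... | no _  = cong (seq (weight t u) n ℚ.+_) (seq-sum (λ y → (α * weight t y) when Forces t y u) n)

  weight-unforced : ∀ {t u} n → (∀ y → ¬ Forces t y u) →
    seq (weight (suc t) u) n ≡ seq (weight t u) n
  weight-unforced {t} {u} n unforced = case em {Filled t u} of λ where
    (yes f) → cong (λ r → seq r n) (weight-filled f)
    (no ¬f) → trans (weight-unfilled n ¬f) (trans
      (cong (seq (weight t u) n ℚ.+_)
        (∑-zero λ y → trans (transmission-onlyIf n t u y) (onlyIf-false (unforced y))))
      (ℚ.+-identityʳ _))

  weight-∉ : ∀ {u} n → u ∉ B → seq (weight 0 u) n ≡ 0ℚ
  weight-∉ {u} n u∉B with em {u ∈ B}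
  ... | yes u∈B = contradiction u∈B u∉B
  ... | no _    = refl

  filled-∈ : ∀ {u} t → u ∈ B → Filled t u
  filled-∈ zero    u∈B = u∈B
  filled-∈ (suc t) u∈B = inj₁ (filled-∈ t u∈B)

  weight-∈ : ∀ {u} t n → u ∈ B → seq (weight t u) n ≡ 1ℚ
  weight-∈ {u} zero n u∈B with em {u ∈ B}
  ... | yes _  = refl
  ... | no u∉B = contradiction u∈B u∉B
  weight-∈ (suc t) n u∈B =
    trans (cong (λ r → seq r n) (weight-filled (filled-∈ t u∈B))) (weight-∈ t n u∈B)

  transmitted⇒filled : ∀ t {y} → Transmitted t y → Filled t y
  transmitted⇒filled (suc t) (inj₁ tr)            = inj₁ (transmitted⇒filled t tr)
  transmitted⇒filled (suc t) (inj₂ (_ , fy , _)) = inj₁ fy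

  module _ {n} (N≤n : N ℕ.≤ n) where

    transmission-nonNeg : ∀ t u → (∀ y → 0ℚ ℚ.≤ seq (weight t y) n) →
                          ∀ y → 0ℚ ℚ.≤ transmission n t u y
    transmission-nonNeg t u 0≤w y = subst (0ℚ ℚ.≤_) (sym (transmission-onlyIf n t u y))
      (onlyIf-nonNeg (*-nonNeg (0≤α n N≤n) (0≤w y)))

    weight-nonNeg : ∀ t u → 0ℚ ℚ.≤ seq (weight t u) n
    weight-nonNeg zero u = case em {u ∈ B} of λ where
      (yes u∈B) → subst (0ℚ ℚ.≤_) (sym (weight-∈ 0 n u∈B)) 0≤1
      (no u∉B)  → ℚ.≤-reflexive (sym (weight-∉ n u∉B))
    weight-nonNeg (suc t) u = case em {Filled t u} of λ where
      (yes f) → subst (λ r → 0ℚ ℚ.≤ seq r n) (sym (weight-filled f)) (weight-nonNeg t u)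
      (no ¬f) → subst (0ℚ ℚ.≤_) (sym (weight-unfilled n ¬f))
        (ℚ.+-mono-≤ (weight-nonNeg t u)
          (∑-nonNeg (transmission-nonNeg t u (weight-nonNeg t))))

  -- Since `≤` on reals is the negation of `<`, it is enough to refute a supposed gap `δ` at a
  -- single index beyond both starting points.
  β≤-if-1≤ : ∀ {r} → (∀ n → N ℕ.≤ n → 1ℚ ℚ.≤ seq r n) → β ≤ r
  β≤-if-1≤ {r} 1≤r (δ , 0<δ , M , r<β) = ℚ.<-irrefl refl (begin-strict
    1ℚ                ≡⟨ ℚ.+-identityʳ 1ℚ ⟨
    1ℚ ℚ.+ 0ℚ         <⟨ ℚ.+-mono-≤-< (1≤r n N≤n) 0<δ ⟩
    seq r n ℚ.+ δ     ≤⟨ r<β n (ℕ.m≤n⊔m N M) ⟩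
    seq β n           ≤⟨ β≤1 n N≤n ⟩
    1ℚ                ∎)
    where
    open ℚ.≤-Reasoning
    n : ℕ
    n = N ℕ.⊔ M
    N≤n : N ℕ.≤ n
    N≤n = ℕ.m≤m⊔n N M

  -- With `r` zero at every index, `ε` itself is a gap below `β`.
  β≰0 : ∀ {r} → (∀ n → seq r n ≡ 0ℚ) → ¬ β ≤ r
  β≰0 {r} r≡0 β≤r = β≤r (ε , 0<ε , N , λ n N≤n →
    subst (ℚ._≤ seq β n) (sym (trans (cong (ℚ._+ ε) (r≡0 n)) (ℚ.+-identityˡ ε))) (ε≤β n N≤n))

  -- Forts of zero forcing: a vertex adjacent to `F` sees at least two vertices of `F`, so while `F`
  -- is entirely unfilled nothing forces into it. Weight zero, unfilledness and absence of forces
  -- are carried by one induction on time.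
  module _ (F : Vertex → Set)
    (fort : ∀ {u y} → F u → y ~ u → ∃ λ u′ → F u′ × u′ ≢ u × y ~ u′)
    (F∩B≡∅ : ∀ {u} → F u → u ∉ B)
    where

    fort-weight   : ∀ t {u} → F u → ∀ n → seq (weight t u) n ≡ 0ℚ
    fort-unfilled : ∀ t {u} → F u → ¬ Filled t u
    fort-unforced : ∀ t {u} → F u → ∀ y → ¬ Forces t y u

    fort-unforced t Fu y (_ , (y~u , _ , only) , _) = case fort Fu y~u of λ where
      (u′ , Fu′ , u′≢u , y~u′) → u′≢u (only u′ y~u′ (fort-unfilled t Fu′))

    fort-weight zero    Fu n = weight-∉ n (F∩B≡∅ Fu)
    fort-weight (suc t) Fu n = trans (weight-unforced n (fort-unforced t Fu)) (fort-weight t Fu n)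

    fort-unfilled zero    Fu           = F∩B≡∅ Fu
    fort-unfilled (suc t) Fu (inj₁ f)  = fort-unfilled t Fu f
    fort-unfilled (suc t) {u} Fu (inj₂ (_ , β≤w)) = β≰0 {weight (suc t) u} (fort-weight (suc t) Fu) β≤w

  -- As `d` vanishes on the initial vertices in `S` and changes by at most one along an edge, `d u`
  -- is a lower bound for the distance from `u` to `B`; the decay estimate needs no exact distance.
  -- The degree bound has the pigeonhole form that `∑-onlyIf-pair` takes.
  module _ (S : Vertex → Set) (d : Vertex → ℕ)
    (closed : ∀ {u y} → S u → y ~ u → S y)
    (degree≤2 : ∀ {u} → S u → ∀ x y z → x ~ u → y ~ u → z ~ u → x ≡ y ⊎ x ≡ z ⊎ y ≡ z)
    (lipschitz : ∀ {u y} → S u → y ~ u → d u ℕ.≤ suc (d y))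
    (d-∈ : ∀ {u} → S u → u ∈ B → d u ≡ 0)
    where

    module _ {n} (N≤n : N ℕ.≤ n) where
      private
        a = seq α n

      0≤a^ : ∀ m → 0ℚ ℚ.≤ a ^ m
      0≤a^ m = ^-nonNeg m (0≤α n N≤n)

      -- A neighbour y of u that has transmitted is charged a^(d u), whether it
      -- transmitted to u or not.
      received : ℕ → Vertex → Vertex → ℚ
      received t u y = (a ^ d u) onlyIf (y ~ u × Transmitted t y)

      received-mono : ∀ t u y → received t u y ℚ.≤ received (suc t) u y
      received-mono t u y = onlyIf-mono-≤ (0≤a^ (d u)) λ (y~u , tr) → y~u , inj₁ tr

      -- One induction on `t` runs through this bound, `forcing-weight` and `received-step`: the
      -- bound at `t` limits what a neighbour sends in the next round, and what it sends is covered
      -- by the increase of its charge.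
      weight≤received : ∀ t {u} → S u → u ∉ B → seq (weight t u) n ℚ.≤ ∑ (received t u)

      -- Only one neighbour of u other than z can have transmitted.
      forcing-weight : ∀ t {u z} → S u → z ~ u → ¬ Transmitted t z → seq (weight t u) n ℚ.≤ a ^ d u
      forcing-weight t {u} {z} Su z~u ¬tr = case em {u ∈ B} of λ where
        (yes u∈B) → ℚ.≤-reflexive (trans (weight-∈ t n u∈B) (cong (a ^_) (sym (d-∈ Su u∈B))))
        (no u∉B)  → ℚ.≤-trans (weight≤received t Su u∉B)
          (∑-onlyIf-unique (0≤a^ (d u)) (λ y → y ~ u × Transmitted t y) λ x y (x~u , tx) (y~u , ty) →
            case degree≤2 Su x y z x~u y~u z~u of λ where
              (inj₁ x≡y)         → x≡y
              (inj₂ (inj₁ refl)) → contradiction tx ¬tr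
              (inj₂ (inj₂ refl)) → contradiction ty ¬tr)

      received-step : ∀ t {u} → S u → ¬ Filled t u → ∀ y →
        received t u y ℚ.+ transmission n t u y ℚ.≤ received (suc t) u y
      received-step t {u} Su ¬fu y = case em {Forces t y u} of λ where
          (yes fo@(_ , (y~u , _) , ¬tr)) → begin
            received t u y ℚ.+ transmission n t u y
              -- A vertex transmits at most once, so before this round the charge of `y` is zero.
              ≡⟨ cong₂ ℚ._+_ (onlyIf-false (¬tr ∘ proj₂))
                   (trans (transmission-onlyIf n t u y) (onlyIf-true fo)) ⟩
            0ℚ ℚ.+ a ℚ.* seq (weight t y) n
              ≡⟨ ℚ.+-identityˡ _ ⟩
            a ℚ.* seq (weight t y) n
              -- Here `u` serves as the neighbour of `y` that has not transmitted: it is unfilled,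
              -- and only filled vertices transmit.
              ≤⟨ ℚ.*-monoˡ-≤-nonNeg a {{ℚ.nonNegative (0≤α n N≤n)}}
                   (forcing-weight t (closed Su y~u) (Graph.~-sym G y~u) (¬fu ∘ transmitted⇒filled t)) ⟩
            a ^ suc (d y)
              ≤⟨ ^-antimono-≤ (0≤α n N≤n) (α≤1 n N≤n) (lipschitz Su y~u) ⟩
            a ^ d u
              ≡⟨ onlyIf-true (y~u , inj₂ (u , fo)) ⟨
            received (suc t) u y ∎
          (no ¬fo) → begin
            received t u y ℚ.+ transmission n t u y
              ≡⟨ cong (received t u y ℚ.+_) (trans (transmission-onlyIf n t u y) (onlyIf-false ¬fo)) ⟩
            received t u y ℚ.+ 0ℚ
              ≡⟨ ℚ.+-identityʳ _ ⟩
            received t u y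
              ≤⟨ received-mono t u y ⟩
            received (suc t) u y ∎
        where
        open ℚ.≤-Reasoning

      weight≤received zero {u} Su u∉B = subst (ℚ._≤ ∑ (received 0 u)) (sym (weight-∉ n u∉B))
        (∑-nonNeg {f = received 0 u} λ y → onlyIf-nonNeg (0≤a^ (d u)))
      weight≤received (suc t) {u} Su u∉B = case em {Filled t u} of λ where
          (yes f) → subst (λ r → seq r n ℚ.≤ ∑ (received (suc t) u)) (sym (weight-filled f))
            (ℚ.≤-trans (weight≤received t Su u∉B)
              (∑-mono-≤ (received-mono t u)))
          (no ¬f) → begin
            seq (weight (suc t) u) n
              ≡⟨ weight-unfilled n ¬f ⟩
            seq (weight t u) n ℚ.+ ∑ (transmission n t u)
              ≤⟨ ℚ.+-monoˡ-≤ (∑ (transmission n t u)) (weight≤received t Su u∉B) ⟩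
            ∑ (received t u) ℚ.+ ∑ (transmission n t u)
              ≡⟨ ∑-distrib-+ (received t u) (transmission n t u) ⟨
            ∑ (λ y → received t u y ℚ.+ transmission n t u y)
              ≤⟨ ∑-mono-≤ (received-step t Su ¬f) ⟩
            ∑ (received (suc t) u) ∎
        where open ℚ.≤-Reasoning

    -- The total weight received is at most 2 α^d; the bound 4 α^d ≤ ε leaves the
    -- positive gap ½ε required by the strict order of the reals.
    far-unfilled : ∀ {u} → S u → u ∉ B → (∀ n → N ℕ.≤ n → 4 · (seq α n ^ d u) ℚ.≤ ε) →
                   ∀ t → ¬ Filled t u
    far-unfilled Su u∉B small zero f = u∉B f
    far-unfilled Su u∉B small (suc t) (inj₁ f) = far-unfilled Su u∉B small t f
    far-unfilled {u} Su u∉B small (suc t) (inj₂ (_ , β≤w)) =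
      β≤w (ℚ.½ ℚ.* ε , 0<½ε , N , λ n N≤n → begin
        seq (weight (suc t) u) n ℚ.+ ℚ.½ ℚ.* ε
          ≤⟨ ℚ.+-monoˡ-≤ (ℚ.½ ℚ.* ε) (ℚ.≤-trans (weight≤received N≤n (suc t) Su u∉B)
               (∑-onlyIf-pair (0≤a^ N≤n (d u)) (λ y → y ~ u × Transmitted (suc t) y) λ x y z (x~u , _) (y~u , _) (z~u , _) →
                 degree≤2 Su x y z x~u y~u z~u)) ⟩
        (seq α n ^ d u ℚ.+ seq α n ^ d u) ℚ.+ ℚ.½ ℚ.* ε
          ≡⟨ solve 2 (λ x e → (x :+ x) :+ con ℚ.½ :* e :=
                              con ℚ.½ :* (x :+ (x :+ (x :+ (x :+ con 0ℚ)))) :+ con ℚ.½ :* e)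
               refl (seq α n ^ d u) ε ⟩
        ℚ.½ ℚ.* (4 · (seq α n ^ d u)) ℚ.+ ℚ.½ ℚ.* ε
          ≤⟨ ℚ.+-monoˡ-≤ (ℚ.½ ℚ.* ε) (ℚ.*-monoˡ-≤-nonNeg ℚ.½ (small n N≤n)) ⟩
        ℚ.½ ℚ.* ε ℚ.+ ℚ.½ ℚ.* ε
          ≡⟨ solve 1 (λ e → con ℚ.½ :* e :+ con ℚ.½ :* e := e) refl ε ⟩
        ε
          ≤⟨ ε≤β n N≤n ⟩
        seq β n ∎)
      where
      open ℚ.≤-Reasoning
      open +-*-Solver
      0<½ε : 0ℚ ℚ.< ℚ.½ ℚ.* ε
      0<½ε = subst (ℚ._< ℚ.½ ℚ.* ε) (ℚ.*-zeroʳ ℚ.½) (ℚ.*-monoʳ-<-pos ℚ.½ 0<ε)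

-- Cardinalities of subsets

module _ {m n} (p : Subset m) (q : Subset n) where

  ∈-++⁺ˡ : ∀ {i} → i ∈ p → i ↑ˡ n ∈ p ++ q
  ∈-++⁺ˡ {i} i∈p = Vec.lookup⇒[]= (i ↑ˡ n) (p ++ q)
    (trans (Vec.lookup-++ˡ p q i) (Vec.[]=⇒lookup i∈p))

  ∈-++⁻ˡ : ∀ {i} → i ↑ˡ n ∈ p ++ q → i ∈ p
  ∈-++⁻ˡ {i} i∈ = Vec.lookup⇒[]= i p
    (trans (sym (Vec.lookup-++ˡ p q i)) (Vec.[]=⇒lookup i∈))

  ∈-++⁻ʳ : ∀ {i} → m ↑ʳ i ∈ p ++ q → i ∈ q
  ∈-++⁻ʳ {i} i∈ = Vec.lookup⇒[]= i q
    (trans (sym (Vec.lookup-++ʳ p q i)) (Vec.[]=⇒lookup i∈))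

∣p++q∣≡∣p∣+∣q∣ : ∀ {m n} (p : Subset m) (q : Subset n) → ∣ p ++ q ∣ ≡ ∣ p ∣ ℕ.+ ∣ q ∣
∣p++q∣≡∣p∣+∣q∣ []            q = refl
∣p++q∣≡∣p∣+∣q∣ (inside  ∷ p) q = cong suc (∣p++q∣≡∣p∣+∣q∣ p q)
∣p++q∣≡∣p∣+∣q∣ (outside ∷ p) q = ∣p++q∣≡∣p∣+∣q∣ p q

n≤1+∣p∣ : ∀ {n} (p : Subset n) → (∀ i j → i ∉ p → j ∉ p → i ≡ j) → n ℕ.≤ suc ∣ p ∣
n≤1+∣p∣ []            unique = z≤n
n≤1+∣p∣ (inside ∷ p)  unique = s≤s (n≤1+∣p∣ p λ i j i∉p j∉p →
  Fin.suc-injective (unique (suc i) (suc j) (i∉p ∘ drop-there) (j∉p ∘ drop-there)))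
-- Index `zero` is the one missed index, so the tail contains everything.
n≤1+∣p∣ {suc n} (outside ∷ p) unique =
  s≤s (subst (ℕ._≤ ∣ p ∣) (∣⊤∣≡n n) (p⊆q⇒∣p∣≤∣q∣ {p = ⊤} {p} λ {i} _ →
    decidable-stable (i ∈? p) λ i∉p →
      case unique zero (suc i) (λ ()) (i∉p ∘ drop-there) of λ ()))

-- `combine` enumerates the indices block by block, so cutting off the first `n` entries removes
-- exactly block `zero`.
blocks≤∣p∣ : ∀ m {n} (p : Subset (m ℕ.* n)) → (∀ (c : Fin m) → ∃ λ (j : Fin n) → combine c j ∈ p) →
             m ℕ.≤ ∣ p ∣
blocks≤∣p∣ zero    p hit = z≤n
blocks≤∣p∣ (suc m) {n} p hit with Vec.splitAt n p
... | q , r , refl = subst (suc m ℕ.≤_) (sym (∣p++q∣≡∣p∣+∣q∣ q r))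
  -- A member of `q` makes `∣ q ∣` positive, since removing it lowers the cardinality.
  (ℕ.+-mono-≤ (ℕ.≤-trans (s≤s z≤n) (x∈p⇒∣p-x∣<∣p∣ (∈-++⁻ˡ q r (proj₂ (hit zero)))))
              (blocks≤∣p∣ m r λ c → proj₁ (hit (suc c)) , ∈-++⁻ʳ q r (proj₂ (hit (suc c)))))

-- At most one leaf is lost and `suc p` block vertices are gained. The `suc` before `combine` skips
-- the centre, which belongs to no block.
star+path≤∣B∣ : ∀ ℓ p n (B : Subset (ℓ ℕ.+ suc (suc p ℕ.* n))) →
  (∀ i j → i ↑ˡ suc (suc p ℕ.* n) ∉ B → j ↑ˡ suc (suc p ℕ.* n) ∉ B → i ≡ j) →
  (∀ (c : Fin (suc p)) → ∃ λ (j : Fin n) → ℓ ↑ʳ suc (combine c j) ∈ B) →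
  ℓ ℕ.+ p ℕ.≤ ∣ B ∣
star+path≤∣B∣ ℓ p n B unique hit with Vec.splitAt ℓ B
... | leaves , v ∷ path , refl = begin
  ℓ ℕ.+ p                       ≤⟨ ℕ.+-monoˡ-≤ p (n≤1+∣p∣ leaves λ i j i∉ j∉ →
                                     unique i j (i∉ ∘ ∈-++⁻ˡ leaves (v ∷ path)) (j∉ ∘ ∈-++⁻ˡ leaves (v ∷ path))) ⟩
  suc ∣ leaves ∣ ℕ.+ p          ≡⟨ ℕ.+-suc ∣ leaves ∣ p ⟨
  ∣ leaves ∣ ℕ.+ suc p          ≤⟨ ℕ.+-monoʳ-≤ ∣ leaves ∣ (ℕ.≤-trans (blocks≤∣p∣ (suc p) path λ c →
                                     proj₁ (hit c) , drop-there (∈-++⁻ʳ leaves (v ∷ path) (proj₂ (hit c))))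
                                     (∣p∣≤∣x∷p∣ v path)) ⟩
  ∣ leaves ∣ ℕ.+ ∣ v ∷ path ∣   ≡⟨ ∣p++q∣≡∣p∣+∣q∣ leaves (v ∷ path) ⟨
  ∣ leaves ++ v ∷ path ∣        ∎
  where open ℕ.≤-Reasoning

-- The star with its path detached

leaf≢path : ∀ {ℓ n} (i : Fin ℓ) (j : Fin n) → i ↑ˡ n ≢ ℓ ↑ʳ j
leaf≢path {ℓ} {n} i j eq
  with () ← trans (sym (Fin.splitAt-↑ˡ ℓ i n)) (trans (cong (splitAt ℓ) eq) (Fin.splitAt-↑ʳ ℓ n j))

∸-lipschitz : ∀ D {x y} → y ℕ.≤ suc x → D ℕ.∸ x ℕ.≤ suc (D ℕ.∸ y)
∸-lipschitz D {x} {y} y≤1+x = ℕ.m≤n+o⇒m∸n≤o D x (begin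
  D                           ≤⟨ ℕ.m≤n+m∸n D y ⟩
  y ℕ.+ (D ℕ.∸ y)             ≤⟨ ℕ.+-monoˡ-≤ (D ℕ.∸ y) y≤1+x ⟩
  suc x ℕ.+ (D ℕ.∸ y)         ≡⟨ ℕ.+-suc x (D ℕ.∸ y) ⟨
  x ℕ.+ suc (D ℕ.∸ y)         ∎)
  where open ℕ.≤-Reasoning

∣n-1+n∣≡1 : ∀ n → ℕ.∣ n - suc n ∣ ≡ 1
∣n-1+n∣≡1 zero    = refl
∣n-1+n∣≡1 (suc n) = ∣n-1+n∣≡1 n

Consecutive : ℕ → ℕ → Set
Consecutive i j = j ≡ suc i ⊎ i ≡ suc j

consecutive-lipschitz : ∀ {i j} m → Consecutive i j → ℕ.∣ j - m ∣ ℕ.≤ suc ℕ.∣ i - m ∣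
consecutive-lipschitz {i} {j} m consec = begin
  ℕ.∣ j - m ∣                       ≤⟨ ℕ.∣-∣-triangle j i m ⟩
  ℕ.∣ j - i ∣ ℕ.+ ℕ.∣ i - m ∣       ≡⟨ cong (ℕ._+ ℕ.∣ i - m ∣) (distance consec) ⟩
  suc ℕ.∣ i - m ∣                   ∎
  where
  open ℕ.≤-Reasoning
  distance : Consecutive i j → ℕ.∣ j - i ∣ ≡ 1
  distance (inj₁ refl) = trans (ℕ.∣-∣-comm (suc i) i) (∣n-1+n∣≡1 i)
  distance (inj₂ refl) = ∣n-1+n∣≡1 j

-- Two of the three numbers lie on the same side of `i`.
consecutive-pair : ∀ {i x y z} → Consecutive i x → Consecutive i y → Consecutive i z →
                   x ≡ y ⊎ x ≡ z ⊎ y ≡ z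
consecutive-pair (inj₁ p) (inj₁ q) _        = inj₁ (trans p (sym q))
consecutive-pair (inj₂ p) (inj₂ q) _        = inj₁ (ℕ.suc-injective (trans (sym p) q))
consecutive-pair (inj₁ p) (inj₂ _) (inj₁ r) = inj₂ (inj₁ (trans p (sym r)))
consecutive-pair (inj₁ _) (inj₂ q) (inj₂ r) = inj₂ (inj₂ (ℕ.suc-injective (trans (sym q) r)))
consecutive-pair (inj₂ _) (inj₁ q) (inj₁ r) = inj₂ (inj₂ (trans q (sym r)))
consecutive-pair (inj₂ p) (inj₁ _) (inj₂ r) = inj₂ (inj₁ (ℕ.suc-injective (trans (sym p) r)))

-- Block `c` occupies the indices from `o` to `o + 2D` and has its midpoint at `o + D`; the offset
-- from `o` is the wanted `j`.
near-block : ∀ {m D} (c : Fin m) (i : Fin (m ℕ.* suc (D ℕ.+ D))) →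
  ℕ.∣ toℕ i - (suc (D ℕ.+ D) ℕ.* toℕ c ℕ.+ D) ∣ ℕ.< D →
  ∃ λ j → i ≡ combine c j
near-block {m} {D} c i near = Fin.fromℕ< i∸o<L , Fin.toℕ-injective (begin-equality
  toℕ i                                       ≡⟨ ℕ.m+[n∸m]≡n o≤i ⟨
  o ℕ.+ (toℕ i ℕ.∸ o)                         ≡⟨ cong (o ℕ.+_) (Fin.toℕ-fromℕ< i∸o<L) ⟨
  o ℕ.+ toℕ (Fin.fromℕ< i∸o<L)                ≡⟨ Fin.toℕ-combine c (Fin.fromℕ< i∸o<L) ⟨
  toℕ (combine c (Fin.fromℕ< i∸o<L))          ∎)
  where
  open ℕ.≤-Reasoning
  o = suc (D ℕ.+ D) ℕ.* toℕ c
  r = ℕ.∣ toℕ i - (o ℕ.+ D) ∣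
  o≤i : o ℕ.≤ toℕ i
  o≤i = ℕ.+-cancelʳ-≤ D o (toℕ i) (begin
    o ℕ.+ D         ≤⟨ ℕ.m≤n+∣n-m∣ (o ℕ.+ D) (toℕ i) ⟩
    toℕ i ℕ.+ r     ≤⟨ ℕ.+-monoʳ-≤ (toℕ i) (ℕ.<⇒≤ near) ⟩
    toℕ i ℕ.+ D     ∎)
  i∸o<L : toℕ i ℕ.∸ o ℕ.< suc (D ℕ.+ D)
  i∸o<L = s≤s (ℕ.m≤n+o⇒m∸n≤o (toℕ i) o (begin
    toℕ i               ≤⟨ ℕ.m≤n+∣m-n∣ (toℕ i) (o ℕ.+ D) ⟩
    o ℕ.+ D ℕ.+ r       ≤⟨ ℕ.+-monoʳ-≤ (o ℕ.+ D) (ℕ.<⇒≤ near) ⟩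
    o ℕ.+ D ℕ.+ D       ≡⟨ ℕ.+-assoc o D D ⟩
    o ℕ.+ (D ℕ.+ D)     ∎))

module Detached (ℓ k : ℕ) .{{_ : NonZero k}} where

  H : Graph
  H = deleteEdge (StarPath ℓ k) (centre ℓ k) (pathNeighbour ℓ k)

  open Graph H using (_~_; Vertex)

  -- The centre is excluded: path i is the vertex number i + 1 of P_{k+1}.
  path : Fin k → Vertex
  path i = ℓ ↑ʳ suc i

  pathNeighbour≡path : (j : Fin k) → toℕ j ≡ 0 → pathNeighbour ℓ k ≡ path j
  pathNeighbour≡path zero refl = refl

  -- Leaves are twins, adjacent to the centre only, and the deleted edge joins two path vertices.
  -- Any two leaves therefore form a fort.
  leaf-fort : ∀ {y} i j → y ~ (i ↑ˡ suc k) → y ~ (j ↑ˡ suc k)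
  leaf-fort {y} i j (adj , _) = adj′ , λ where
      (inj₁ (_ , eq)) → leaf≢pathNeighbour k eq
      (inj₂ (_ , eq)) → leaf≢path j zero eq
    where
    leaf≢pathNeighbour : ∀ k .{{_ : NonZero k}} → j ↑ˡ suc k ≢ pathNeighbour ℓ k
    leaf≢pathNeighbour (suc k) = leaf≢path j (suc zero)
    adj′ : StarPathAdj (splitAt ℓ y) (splitAt ℓ (j ↑ˡ suc k))
    adj′ rewrite Fin.splitAt-↑ˡ ℓ i (suc k) | Fin.splitAt-↑ˡ ℓ j (suc k) with splitAt ℓ y
    ... | inj₂ _ = adj

  path-neighbour : ∀ {y} i → y ~ path i → ∃ λ j → y ≡ path j × Consecutive (toℕ i) (toℕ j)
  path-neighbour {y} i (adj , kept)
    rewrite Fin.splitAt-↑ʳ ℓ (suc k) (suc i) with splitAt ℓ y in eq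
  ... | inj₁ _ = case adj of λ ()
  -- Here `y` is the centre, whose only path neighbour is x, and that edge has been deleted.
  ... | inj₂ zero = case adj of λ where
    (inj₁ 1+i≡1) → contradiction
      (inj₁ (sym (Fin.splitAt⁻¹-↑ʳ eq) , sym (pathNeighbour≡path i (ℕ.suc-injective 1+i≡1)))) kept
  ... | inj₂ (suc j) = j , sym (Fin.splitAt⁻¹-↑ʳ eq) , (case adj of λ where
    (inj₁ i≡1+j) → inj₂ (ℕ.suc-injective i≡1+j)
    (inj₂ j≡1+i) → inj₁ (ℕ.suc-injective j≡1+i))

forced-size : (em : ExcludedMiddle 0ℓ) {α β : ℝ} {ε : ℚ} {N : ℕ} → Separated α β ε N →
  ∀ D → (∀ n → N ℕ.≤ n → 4 · (seq α n ^ D) ℚ.≤ ε) → ∀ ℓ p →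
  (let H = Detached.H ℓ (suc p ℕ.* suc (D ℕ.+ D))) →
  ∀ B → Process.IsForcingSet em α β H B → ℓ ℕ.+ p ℕ.≤ ∣ B ∣
forced-size em {α} {β} {ε} sep D small ℓ p B (t , filled) =
    star+path≤∣B∣ ℓ p (suc (D ℕ.+ D)) B leaves-unique blocks-hit
  where
  k = suc p ℕ.* suc (D ℕ.+ D)
  open Detached ℓ k
  open Graph H using (Vertex)
  open Dynamics em sep H B

  leaves-unique : ∀ i j → i ↑ˡ suc k ∉ B → j ↑ˡ suc k ∉ B → i ≡ j
  leaves-unique i j i∉B j∉B = decidable-stable (i Fin.≟ j) λ i≢j →
    fort-unfilled (λ u → u ≡ i ↑ˡ suc k ⊎ u ≡ j ↑ˡ suc k)
      (λ where
        (inj₁ refl) y~i → j ↑ˡ suc k , inj₂ refl , i≢j ∘ sym ∘ Fin.↑ˡ-injective (suc k) j i , leaf-fort i j y~i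
        (inj₂ refl) y~j → i ↑ˡ suc k , inj₁ refl , i≢j ∘ Fin.↑ˡ-injective (suc k) i j , leaf-fort j i y~j)
      (λ where
        (inj₁ refl) → i∉B
        (inj₂ refl) → j∉B)
      t (inj₁ refl) (filled (i ↑ˡ suc k))

  module _ (c : Fin (suc p)) (missed : ∀ j → path (combine c j) ∉ B) where

    mid : ℕ
    mid = suc (D ℕ.+ D) ℕ.* toℕ c ℕ.+ D

    middle : Fin k
    middle = combine c (fromℕ D ↑ˡ D)

    toℕ-middle : toℕ middle ≡ mid
    toℕ-middle = trans (Fin.toℕ-combine c (fromℕ D ↑ˡ D))
      (cong (suc (D ℕ.+ D) ℕ.* toℕ c ℕ.+_) (trans (Fin.toℕ-↑ˡ (fromℕ D) D) (Fin.toℕ-fromℕ D)))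

    -- Positions are those on P_{k+1}, where `path i` sits at `suc i`, hence `suc mid`; leaves get
    -- the dummy position 0. Truncated subtraction makes the depth zero at distance `D` or more from
    -- the middle.
    depth : Vertex → ℕ
    depth u = D ℕ.∸ ℕ.∣ [ const 0 , toℕ ]′ (splitAt ℓ u) - suc mid ∣

    depth-path : ∀ i → depth (path i) ≡ D ℕ.∸ ℕ.∣ toℕ i - mid ∣
    depth-path i rewrite Fin.splitAt-↑ʳ ℓ (suc k) (suc i) = refl

    depth-middle : depth (path middle) ≡ D
    depth-middle = trans (depth-path middle)
      (cong (D ℕ.∸_) (trans (cong (ℕ.∣_- mid ∣) toℕ-middle) (ℕ.∣n-n∣≡0 mid)))

    OnPath : Vertex → Set
    OnPath u = ∃ λ i → u ≡ path i

    middle-unfilled : ¬ Filled t (path middle)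
    middle-unfilled = far-unfilled OnPath depth
      (λ where (i , refl) y~u → case path-neighbour i y~u of λ where (j , eq , _) → j , eq)
      (λ where
        (i , refl) x y z x~u y~u z~u →
          case path-neighbour i x~u , path-neighbour i y~u , path-neighbour i z~u of λ where
            ((a , refl , ia) , (b , refl , ib) , (c , refl , ic)) →
              map (cong path ∘ Fin.toℕ-injective)
                (map (cong path ∘ Fin.toℕ-injective) (cong path ∘ Fin.toℕ-injective))
                (consecutive-pair ia ib ic))
      (λ where
        (i , refl) y~u → case path-neighbour i y~u of λ where
          (j , refl , ij) → subst₂ (λ a b → a ℕ.≤ suc b) (sym (depth-path i)) (sym (depth-path j))
            (∸-lipschitz D (consecutive-lipschitz mid ij)))
      (λ where
        -- An initial vertex nearer than `D` to the middle would lie in the missed block; at any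
        -- other the depth is truncated to zero.
        (i , refl) i∈B → trans (depth-path i) (ℕ.m≤n⇒m∸n≡0 {D} (ℕ.≮⇒≥ λ near →
          case near-block {suc p} {D} c i near of λ where (j , refl) → missed j i∈B)))
      (middle , refl) (missed (fromℕ D ↑ˡ D))
      (λ n N≤n → subst (λ d → 4 · (seq α n ^ d) ℚ.≤ ε) (sym depth-middle) (small n N≤n))
      t

  blocks-hit : ∀ c → ∃ λ j → path (combine c j) ∈ B
  blocks-hit c = decidable-stable (Fin.any? λ j → path (combine c j) ∈? B) λ none →
    middle-unfilled c (λ j j∈B → none (j , j∈B)) (filled (path (middle c λ j j∈B → none (j , j∈B))))

-- The star with its path attached

1≤m·1 : ∀ m .{{_ : NonZero m}} → 1ℚ ℚ.≤ m · 1ℚ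
1≤m·1 (suc m) = subst (ℚ._≤ suc m · 1ℚ) (ℚ.+-identityʳ 1ℚ) (ℚ.+-monoʳ-≤ 1ℚ (·-nonNeg m 0≤1))

module Attached (em : ExcludedMiddle 0ℓ) {α β : ℝ} {ε : ℚ} {N : ℕ} (sep : Separated α β ε N)
                (K : ℕ) .{{_ : NonZero K}} (1≤Kε : 1ℚ ℚ.≤ K · ε)
                (ℓ k : ℕ) (ℓ≡K^1+k : ℓ ≡ K ℕ.^ suc k) where

  G : Graph
  G = StarPath ℓ k

  leaves : Subset (Graph.order G)
  leaves = ⊤ {ℓ} ++ ⊥ {suc k}

  ∣leaves∣≡ℓ : ∣ leaves ∣ ≡ ℓ
  ∣leaves∣≡ℓ = begin
    ∣ leaves ∣                        ≡⟨ ∣p++q∣≡∣p∣+∣q∣ (⊤ {ℓ}) ⊥ ⟩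
    ∣ ⊤ {ℓ} ∣ ℕ.+ ∣ ⊥ {suc k} ∣       ≡⟨ cong₂ ℕ._+_ (∣⊤∣≡n ℓ) (∣⊥∣≡0 (suc k)) ⟩
    ℓ ℕ.+ 0                           ≡⟨ ℕ.+-identityʳ ℓ ⟩
    ℓ                                 ∎
    where open ≡-Reasoning

  open Graph G using (_~_; Vertex)
  open Separated sep
  open Indicator em
  open Dynamics em sep G leaves

  leaf : Fin ℓ → Vertex
  leaf i = i ↑ˡ suc k

  path : Fin (suc k) → Vertex
  path i = ℓ ↑ʳ i

  data View : Vertex → Set where
    is-leaf : ∀ i → View (leaf i)
    is-path : ∀ i → View (path i)

  view : ∀ u → View u
  view u with splitAt ℓ u in eq
  ... | inj₁ i = subst View (Fin.splitAt⁻¹-↑ˡ eq) (is-leaf i)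
  ... | inj₂ i = subst View (Fin.splitAt⁻¹-↑ʳ eq) (is-path i)

  leaf~path⇒ : ∀ i j → leaf i ~ path j → j ≡ zero
  leaf~path⇒ i j adj rewrite Fin.splitAt-↑ˡ ℓ i (suc k) | Fin.splitAt-↑ʳ ℓ (suc k) j = adj

  leaf~centre : ∀ i → leaf i ~ path zero
  leaf~centre i rewrite Fin.splitAt-↑ˡ ℓ i (suc k) | Fin.splitAt-↑ʳ ℓ (suc k) zero = refl

  leaf≁leaf : ∀ i j → ¬ leaf i ~ leaf j
  leaf≁leaf i j adj rewrite Fin.splitAt-↑ˡ ℓ i (suc k) | Fin.splitAt-↑ˡ ℓ j (suc k) = adj

  path~path⇒ : ∀ i j → path i ~ path j → Consecutive (toℕ i) (toℕ j)
  path~path⇒ i j adj rewrite Fin.splitAt-↑ʳ ℓ (suc k) i | Fin.splitAt-↑ʳ ℓ (suc k) j = adj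

  path~path⇐ : ∀ i j → Consecutive (toℕ i) (toℕ j) → path i ~ path j
  path~path⇐ i j adj rewrite Fin.splitAt-↑ʳ ℓ (suc k) i | Fin.splitAt-↑ʳ ℓ (suc k) j = adj

  leaf-∈ : ∀ i → leaf i ∈ leaves
  leaf-∈ i = ∈-++⁺ˡ ⊤ ⊥ (∈⊤ {x = i})

  path-∉ : ∀ i → path i ∉ leaves
  path-∉ i i∈ = ∉⊥ (∈-++⁻ʳ (⊤ {ℓ}) ⊥ i∈)

  -- From 1 ≤ Kε ≤ Kα, one factor `K` pays for one multiplication by α.
  K·α : ∀ {n} → N ℕ.≤ n → ∀ m → (m · 1ℚ) ℚ.≤ (K ℕ.* m) · seq α n
  K·α {n} N≤n m = begin
    m · 1ℚ                      ≤⟨ ·-monoʳ-≤ m (ℚ.≤-trans 1≤Kε (·-monoʳ-≤ K (ε≤α n N≤n))) ⟩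
    m · (K · seq α n)           ≡⟨ ×-assocˡ (seq α n) m K ⟩
    (m ℕ.* K) · seq α n         ≡⟨ cong (_· seq α n) (ℕ.*-comm m K) ⟩
    (K ℕ.* m) · seq α n         ∎
    where open ℚ.≤-Reasoning

  -- The weight K^(k−i) of path vertex i is what remains of ℓ = K^(k+1) after
  -- i + 1 multiplications by α, as α ≥ 1/K.
  record Front (t : ℕ) : Set where
    field
      behind-filled      : ∀ i → toℕ i ℕ.< t → Filled t (path i)
      behind-weight      : ∀ i → toℕ i ℕ.< t → ∀ n → N ℕ.≤ n →
                           (K ℕ.^ (k ℕ.∸ toℕ i)) · 1ℚ ℚ.≤ seq (weight t (path i)) n
      ahead-unfilled     : ∀ i → t ℕ.≤ toℕ i → ¬ Filled t (path i)
      ahead-weight       : ∀ i → t ℕ.≤ toℕ i → ∀ n → seq (weight t (path i)) n ≡ 0ℚ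
      transmitted-behind : ∀ i → Transmitted t (path i) → suc (toℕ i) ℕ.< t

  open Front

  front-zero : Front 0
  front-zero = record
    { behind-filled      = λ _ ()
    ; behind-weight      = λ _ ()
    ; ahead-unfilled     = λ i _ → path-∉ i
    ; ahead-weight       = λ i _ n → weight-∉ n (path-∉ i)
    ; transmitted-behind = λ _ ()
    }

  single≤weight : ∀ {t y u n} → N ℕ.≤ n → ¬ Filled t u → Forces t y u →
                  seq α n ℚ.* seq (weight t y) n ℚ.≤ seq (weight (suc t) u) n
  single≤weight {t} {y} {u} {n} N≤n ¬fu y→u = begin
    seq α n ℚ.* seq (weight t y) n
      ≡⟨ trans (transmission-onlyIf n t u y) (onlyIf-true y→u) ⟨
    transmission n t u y
      ≤⟨ term≤∑ (transmission-nonNeg N≤n t u (weight-nonNeg N≤n t)) y ⟩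
    ∑ (transmission n t u)
      ≡⟨ ℚ.+-identityˡ _ ⟨
    0ℚ ℚ.+ ∑ (transmission n t u)
      ≤⟨ ℚ.+-monoˡ-≤ (∑ (transmission n t u)) (weight-nonNeg N≤n t u) ⟩
    seq (weight t u) n ℚ.+ ∑ (transmission n t u)
      ≡⟨ weight-unfilled n ¬fu ⟨
    seq (weight (suc t) u) n ∎
    where open ℚ.≤-Reasoning

  leaf-forces-centre : Front 0 → ∀ i → Forces 0 (leaf i) (path zero)
  leaf-forces-centre front i = leaf-∈ i
    , (leaf~centre i , path-∉ zero , λ y adj ¬fy → only y (view y) adj)
    , λ ()
    where
    only : ∀ y → View y → leaf i ~ y → y ≡ path zero
    only _ (is-leaf j) adj = contradiction adj (leaf≁leaf i j)
    only _ (is-path j) adj = cong path (leaf~path⇒ i j adj)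

  -- Of the neighbours of path vertex t, any leaves are initial and vertex t - 1, if there is one,
  -- is already filled, which leaves vertex t + 1 alone.
  path-forces-next : ∀ {t} → Front (suc t) → ∀ i → toℕ i ≡ t →
                     Forces (suc t) (path (inject₁ i)) (path (suc i))
  path-forces-next {t} front i refl =
      behind-filled front (inject₁ i) (s≤s (ℕ.≤-reflexive i≡))
    , (path~path⇐ (inject₁ i) (suc i) (inj₁ (cong suc (sym i≡)))
      , ahead-unfilled front (suc i) ℕ.≤-refl
      , λ y adj ¬fy → only y (view y) adj ¬fy)
    -- The delay in `transmitted-behind` matters here: the vertex filled last has not transmitted
    -- yet, as that would give `suc t < suc t`.
    , λ tr → ℕ.<-irrefl (cong suc i≡) (transmitted-behind front (inject₁ i) tr)
    where
    i≡ : toℕ (inject₁ i) ≡ toℕ i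
    i≡ = Fin.toℕ-inject₁ i
    only : ∀ y → View y → path (inject₁ i) ~ y → ¬ Filled (suc t) y → y ≡ path (suc i)
    only _ (is-leaf j) adj ¬fy = contradiction (filled-∈ (suc t) (leaf-∈ j)) ¬fy
    only _ (is-path j) adj ¬fy = case path~path⇒ (inject₁ i) j adj of λ where
      (inj₁ j≡1+i) → cong path (Fin.toℕ-injective (trans j≡1+i (cong suc i≡)))
      (inj₂ i≡1+j) → contradiction
        (behind-filled front j (ℕ.m≤n⇒m≤1+n (ℕ.≤-reflexive (trans (sym i≡1+j) i≡)))) ¬fy

  -- The centre collects α from each of the `K ^ suc k` leaves, and every later vertex collects α
  -- times the weight of its predecessor. In both cases `K·α` trades one factor `K` for the α.
  front-weight : ∀ {t} → Front t → ∀ i → toℕ i ≡ t → ∀ n → N ℕ.≤ n →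
                 (K ℕ.^ (k ℕ.∸ toℕ i)) · 1ℚ ℚ.≤ seq (weight (suc t) (path i)) n
  front-weight front zero refl n N≤n = begin
    (K ℕ.^ k) · 1ℚ
      ≤⟨ K·α N≤n (K ℕ.^ k) ⟩
    (K ℕ.^ suc k) · seq α n
      ≡⟨ cong (_· seq α n) ℓ≡K^1+k ⟨
    ℓ · seq α n
      ≤⟨ ·≤∑ ℓ (transmission-nonNeg N≤n 0 (path zero) (weight-nonNeg N≤n 0)) (λ i →
           ℚ.≤-reflexive (sym (trans (transmission-onlyIf n 0 (path zero) (leaf i))
             (trans (onlyIf-true (leaf-forces-centre front i))
               (trans (cong (seq α n ℚ.*_) (weight-∈ 0 n (leaf-∈ i))) (ℚ.*-identityʳ _)))))) ⟩
    ∑ (transmission n 0 (path zero))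
      ≡⟨ ℚ.+-identityˡ _ ⟨
    0ℚ ℚ.+ ∑ (transmission n 0 (path zero))
      ≡⟨ cong (ℚ._+ ∑ (transmission n 0 (path zero))) (ahead-weight front zero z≤n n) ⟨
    seq (weight 0 (path zero)) n ℚ.+ ∑ (transmission n 0 (path zero))
      ≡⟨ weight-unfilled n (path-∉ zero) ⟨
    seq (weight 1 (path zero)) n ∎
    where open ℚ.≤-Reasoning
  front-weight {suc t} front (suc i) refl n N≤n = begin
    (K ℕ.^ (k ℕ.∸ suc (toℕ i))) · 1ℚ
      ≤⟨ K·α N≤n (K ℕ.^ (k ℕ.∸ suc (toℕ i))) ⟩
    (K ℕ.^ suc (k ℕ.∸ suc (toℕ i))) · seq α n
      -- Here `i : Fin k`, so the subtraction is not truncated and the exponent can absorb the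
      -- successor.
      ≡⟨ cong (λ e → (K ℕ.^ e) · seq α n) (ℕ.+-∸-assoc 1 (Fin.toℕ<n i)) ⟨
    (K ℕ.^ (k ℕ.∸ toℕ i)) · seq α n
      ≡⟨ cong (λ j → (K ℕ.^ (k ℕ.∸ j)) · seq α n) i≡ ⟨
    (K ℕ.^ (k ℕ.∸ toℕ (inject₁ i))) · seq α n
      ≡⟨ cong ((K ℕ.^ (k ℕ.∸ toℕ (inject₁ i))) ·_) (ℚ.*-identityʳ (seq α n)) ⟨
    (K ℕ.^ (k ℕ.∸ toℕ (inject₁ i))) · (seq α n ℚ.* 1ℚ)
      ≡⟨ ×-comm-* (K ℕ.^ (k ℕ.∸ toℕ (inject₁ i))) (seq α n) 1ℚ ⟨
    seq α n ℚ.* ((K ℕ.^ (k ℕ.∸ toℕ (inject₁ i))) · 1ℚ)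
      ≤⟨ ℚ.*-monoˡ-≤-nonNeg (seq α n) {{ℚ.nonNegative (0≤α n N≤n)}}
           (behind-weight front (inject₁ i) (s≤s (ℕ.≤-reflexive i≡)) n N≤n) ⟩
    seq α n ℚ.* seq (weight (suc t) (path (inject₁ i))) n
      ≤⟨ single≤weight N≤n (ahead-unfilled front (suc i) ℕ.≤-refl) (path-forces-next front i refl) ⟩
    seq (weight (suc (suc t)) (path (suc i))) n ∎
    where
    open ℚ.≤-Reasoning
    i≡ : toℕ (inject₁ i) ≡ toℕ i
    i≡ = Fin.toℕ-inject₁ i

  -- A power of the nonzero `K` is at least 1, and β ≤ 1.
  front-filled : ∀ {t} → Front t → ∀ i → toℕ i ≡ t → Filled (suc t) (path i)
  front-filled {t} front i refl = inj₂
    ( ahead-unfilled front i ℕ.≤-refl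
    , β≤-if-1≤ {weight (suc t) (path i)} λ n N≤n →
        ℚ.≤-trans (1≤m·1 (K ℕ.^ (k ℕ.∸ toℕ i)) {{ℕ.m^n≢0 K (k ℕ.∸ toℕ i)}}) (front-weight front i refl n N≤n))

  -- A vertex with index above `t` is not the centre, so it has no leaf neighbour, and its path
  -- neighbours have index at least `t` and are unfilled.
  ahead-unforced : ∀ {t} → Front t → ∀ i → t ℕ.< toℕ i → ∀ y → ¬ Forces t y (path i)
  ahead-unforced {t} front i t<i y (fy , (y~i , _) , _) = ¬adjacent (view y) fy y~i
    where
    before : ∀ j → Consecutive (toℕ j) (toℕ i) → t ℕ.≤ toℕ j
    before j (inj₁ i≡1+j) = ℕ.s≤s⁻¹ (subst (t ℕ.<_) i≡1+j t<i)
    before j (inj₂ j≡1+i) = ℕ.≤-trans (ℕ.<⇒≤ t<i) (subst (toℕ i ℕ.≤_) (sym j≡1+i) (ℕ.n≤1+n (toℕ i)))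
    ¬adjacent : ∀ {y} → View y → Filled t y → ¬ y ~ path i
    ¬adjacent (is-leaf j) _ j~i = ℕ.n≮0 (subst (t ℕ.<_) (cong toℕ (leaf~path⇒ j i j~i)) t<i)
    ¬adjacent (is-path j) fj j~i = ahead-unfilled front j (before j (path~path⇒ j i j~i)) fj

  front-suc : ∀ {t} → Front t → Front (suc t)
  front-suc {t} front = record
    { behind-filled      = λ i i<1+t → case ℕ.m<1+n⇒m<n∨m≡n i<1+t of λ where
        (inj₁ i<t) → inj₁ (behind-filled front i i<t)
        (inj₂ i≡t) → front-filled front i i≡t
    ; behind-weight      = λ i i<1+t n N≤n → case ℕ.m<1+n⇒m<n∨m≡n i<1+t of λ where
        (inj₁ i<t) → subst (λ r → (K ℕ.^ (k ℕ.∸ toℕ i)) · 1ℚ ℚ.≤ seq r n)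
          (sym (weight-filled (behind-filled front i i<t))) (behind-weight front i i<t n N≤n)
        (inj₂ i≡t) → front-weight front i i≡t n N≤n
    ; ahead-unfilled     = λ where
        i t<i (inj₁ f)         → ahead-unfilled front i (ℕ.<⇒≤ t<i) f
        i t<i (inj₂ (_ , β≤w)) → β≰0 {weight (suc t) (path i)} (ahead-weight′ i t<i) β≤w
    ; ahead-weight       = ahead-weight′
    ; transmitted-behind = λ where
        i (inj₁ tr)            → ℕ.m≤n⇒m≤1+n (transmitted-behind front i tr)
        -- A vertex that transmits now was filled at time `t`, so its index is below `t`.
        i (inj₂ (_ , fi , _)) → s≤s (ℕ.≰⇒> λ t≤i → ahead-unfilled front i t≤i fi)
    }
    where
    ahead-weight′ : ∀ i → t ℕ.< toℕ i → ∀ n → seq (weight (suc t) (path i)) n ≡ 0ℚ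
    ahead-weight′ i t<i n = trans (weight-unforced n (ahead-unforced front i t<i))
                                  (ahead-weight front i (ℕ.<⇒≤ t<i) n)

  front : ∀ t → Front t
  front zero    = front-zero
  front (suc t) = front-suc (front t)

  leaves-force : Process.IsForcingSet em α β G leaves
  -- One path vertex is filled per round, and there are k + 1 of them, the centre included.
  leaves-force = suc k , λ u → filled (view u)
    where
    filled : ∀ {u} → View u → Filled (suc k) u
    filled (is-leaf i) = filled-∈ (suc k) (leaf-∈ i)
    filled (is-path i) = behind-filled (front (suc k)) i (Fin.toℕ<n i)

-- Choice of the parameters and the gap

decay-exponent : ∀ {α β ε N} → Separated α β ε N →
                 ∃ λ D → ∀ n → N ℕ.≤ n → 4 · (seq α n ^ D) ℚ.≤ ε
-- From 4 ≤ Dε², one factor ε remains as the final bound and the other forms Dε, for which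
-- `geometric-decay` gives α^D · Dε ≤ 1. Only ε enters the choice, so `D` is uniform in `n`.
decay-exponent {α} {β} {ε} {N} sep with archimedean-· {ε ℚ.* ε} 0<ε² (4 · 1ℚ)
  where
  open Separated sep
  0<ε² : 0ℚ ℚ.< ε ℚ.* ε
  0<ε² = subst (ℚ._< ε ℚ.* ε) (ℚ.*-zeroʳ ε) (ℚ.*-monoʳ-<-pos ε {{ℚ.positive 0<ε}} 0<ε)
... | D , 4≤D·ε² = D , λ n N≤n → begin
    4 · (seq α n ^ D)
      ≡⟨ cong (4 ·_) (ℚ.*-identityˡ (seq α n ^ D)) ⟨
    4 · (1ℚ ℚ.* seq α n ^ D)
      ≡⟨ ×-assoc-* 4 1ℚ (seq α n ^ D) ⟨
    (4 · 1ℚ) ℚ.* seq α n ^ D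
      ≤⟨ ℚ.*-monoʳ-≤-nonNeg (seq α n ^ D) {{ℚ.nonNegative (0≤αᴰ n N≤n)}} 4≤D·ε² ⟩
    (D · (ε ℚ.* ε)) ℚ.* seq α n ^ D
      ≡⟨ cong (ℚ._* seq α n ^ D) (×-assoc-* D ε ε) ⟨
    (D · ε) ℚ.* ε ℚ.* seq α n ^ D
      ≡⟨ solve 3 (λ x e y → x :* e :* y := e :* (y :* x)) refl (D · ε) ε (seq α n ^ D) ⟩
    ε ℚ.* (seq α n ^ D ℚ.* (D · ε))
      ≤⟨ ℚ.*-monoˡ-≤-nonNeg ε {{ℚ.nonNegative 0≤ε}} (ℚ.*-monoˡ-≤-nonNeg (seq α n ^ D)
           {{ℚ.nonNegative (0≤αᴰ n N≤n)}} D·ε≤1+D·ε) ⟩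
    ε ℚ.* (seq α n ^ D ℚ.* (1ℚ ℚ.+ D · ε))
      ≤⟨ ℚ.*-monoˡ-≤-nonNeg ε {{ℚ.nonNegative 0≤ε}}
           (geometric-decay (0≤α n N≤n) 0≤ε (α+ε≤1 n N≤n) D) ⟩
    ε ℚ.* 1ℚ
      ≡⟨ ℚ.*-identityʳ ε ⟩
    ε ∎
  where
  open ℚ.≤-Reasoning
  open +-*-Solver
  open Separated sep
  0≤αᴰ : ∀ n → N ℕ.≤ n → 0ℚ ℚ.≤ seq α n ^ D
  0≤αᴰ n N≤n = ^-nonNeg D (0≤α n N≤n)
  D·ε≤1+D·ε : D · ε ℚ.≤ 1ℚ ℚ.+ D · ε
  D·ε≤1+D·ε = subst (ℚ._≤ 1ℚ ℚ.+ D · ε) (ℚ.+-identityˡ (D · ε)) (ℚ.+-monoˡ-≤ (D · ε) 0≤1)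

Z-gap : (em : ExcludedMiddle 0ℓ) {α β : ℝ} {ε : ℚ} {N : ℕ} → Separated α β ε N →
  ∀ D → (∀ n → N ℕ.≤ n → 4 · (seq α n ^ D) ℚ.≤ ε) →
  ∀ K → .{{_ : NonZero K}} → 1ℚ ℚ.≤ K · ε →
  ∀ p ℓ → (let k = suc p ℕ.* suc (D ℕ.+ D)) → ℓ ≡ K ℕ.^ suc k →
  Z em α β (Detached.H ℓ k) ⊖ Z em α β (StarPath ℓ k) ≥ + p
Z-gap em {α} {β} sep D small K 1≤Kε p ℓ ℓ≡ =
  -- The integer difference agrees with truncated subtraction because Z(G) ≤ Z(H).
  subst (+ p ℤ.≤_) (sym (ℤ.⊖-≥ ZG≤ZH)) (ℤ.+≤+ p≤ZH∸ZG)
  where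
  k = suc p ℕ.* suc (D ℕ.+ D)
  open Attached em sep K 1≤Kε ℓ k ℓ≡ using (G; leaves; ∣leaves∣≡ℓ; leaves-force)
  H = Detached.H ℓ k
  ZG = Z em α β G
  ZH = Z em α β H
  ZG≤ℓ : ZG ℕ.≤ ℓ
  ZG≤ℓ = proj₂ (proj₂ (Process.forcingNumber em α β G)) ℓ (leaves , ∣leaves∣≡ℓ , leaves-force)
  ℓ+p≤ZH : ℓ ℕ.+ p ℕ.≤ ZH
  ℓ+p≤ZH with proj₁ (proj₂ (Process.forcingNumber em α β H))
  ... | B , ∣B∣≡ZH , forcing = subst (ℓ ℕ.+ p ℕ.≤_) ∣B∣≡ZH (forced-size em sep D small ℓ p B forcing)
  ZG+p≤ZH : ZG ℕ.+ p ℕ.≤ ZH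
  ZG+p≤ZH = ℕ.≤-trans (ℕ.+-monoˡ-≤ p ZG≤ℓ) ℓ+p≤ZH
  ZG≤ZH : ZG ℕ.≤ ZH
  ZG≤ZH = ℕ.m+n≤o⇒m≤o ZG ZG+p≤ZH
  p≤ZH∸ZG : p ℕ.≤ ZH ℕ.∸ ZG
  p≤ZH∸ZG = ℕ.m+n≤o⇒m≤o∸n p (subst (ℕ._≤ ZH) (ℕ.+-comm ZG p) ZG+p≤ZH)

theorem5p2p1 : (em : ExcludedMiddle 0ℓ) →
    ∀ (α β : ℝ) → 0ℝ < α → α < 1ℝ → 0ℝ < β → β < 1ℝ →
    ∀ (p : ℕ) → .{{_ : NonZero p}} →
    ∃₂ λ (k ℓ : ℕ) → Σ (NonZero k) λ k≢0 → NonZero ℓ ×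
    Z em α β (deleteEdge (StarPath ℓ k) (centre ℓ k) (pathNeighbour ℓ k {{k≢0}})) ⊖ Z em α β (StarPath ℓ k) ≥ + p
theorem5p2p1 em α β 0<α α<1 0<β β<1 p = separated (separate {α} {β} 0<α α<1 0<β β<1)
  where
  Goal : Set
  Goal = ∃₂ λ (k ℓ : ℕ) → Σ (NonZero k) λ k≢0 → NonZero ℓ ×
    Z em α β (deleteEdge (StarPath ℓ k) (centre ℓ k) (pathNeighbour ℓ k {{k≢0}})) ⊖ Z em α β (StarPath ℓ k) ≥ + p

  witnesses : ∀ {ε N} → Separated α β ε N → (∃ λ D → ∀ n → N ℕ.≤ n → 4 · (seq α n ^ D) ℚ.≤ ε) →
              (∃ λ K → 1ℚ ℚ.≤ K · ε) → Goal
  witnesses sep _           (zero  , 1≤0)  = contradiction 1≤0 λ where (ℚ.*≤* (ℤ.+≤+ ()))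
  -- `D` and `K` depend on ε alone; then `D` and `p` fix `k` as p + 1 blocks of length 2D + 1, and ℓ
  -- comes last, since the weight must survive the whole path.
  witnesses sep (D , small) (suc K , 1≤Kε) = k , suc K ℕ.^ suc k , _ , ℕ.m^n≢0 (suc K) (suc k) ,
    Z-gap em sep D small (suc K) 1≤Kε p (suc K ℕ.^ suc k) refl
    where
    k = suc p ℕ.* suc (D ℕ.+ D)

  separated : (∃₂ λ ε N → Separated α β ε N) → Goal
  separated (ε , N , sep) = witnesses sep (decay-exponent sep) (archimedean-· (Separated.0<ε sep) 1ℚ)
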